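{- Let $b\ge2$ and $n\ge1$. The number $N'(b,n)$ of prime $b$-ball juggling patterns of period $n$ satisfies $$N'(b,n)\ge\frac1b\sum_{t\ge1}\sum_{\substack{p_1>\cdots>p_t\ge1\\ p_1+\cdots+p_t=n}}\frac{(b-1)^n}{\binom{t+b-1}{b}}\prod_{i=1}^t\left(\frac{i+b-1}{i+b-2}\right)^{p_i}.$$
   Context: A $b$-ball juggling state is a sequence $\alpha=(\alpha_1,\alpha_2,\dots)$ with $\alpha_i\in\{0,1\}$, finitely many nonzero, and $\sum_i\alpha_i=b$ ($\alpha_i=1$ means a ball lands $i$ beats from now). There is a transition $\alpha\to\beta$ iff $\alpha_{i+1}\le\beta_i$ for all $i\ge1$. A prime $b$-ball juggling pattern of period $n$ is a directed cycle of length $n$ in this (infinite) state graph, i.e. a closed walk of length $n$ visiting $n$ distinct states, counted up to cyclic rotation. -}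

module Defs where

open import Data.Bool using (Bool; true; false)
open import Data.Nat as ℕ using (ℕ; zero; suc; _+_; _∸_; _≤_; _<_; _≤ᵇ_)
open import Data.Nat.Combinatorics using (_C_)
open import Data.Integer using (+_)
open import Data.List using (List; []; _∷_; _++_; map; length)
open import Data.Product using (Σ; ∃; _×_; _,_)
open import Data.Empty using (⊥)
open import Data.List.Relation.Unary.AllPairs using (AllPairs)
open import Relation.Nullary using (¬_)
open import Relation.Binary.PropositionalEquality using (_≡_)
import Data.Rational as ℚ
open ℚ using (ℚ)

-- Juggling states.
-- A state α = (α₁, α₂, …) is encoded as  seq : ℕ → Bool  with
-- seq i = α_{i+1}  (0-based indexing; true means 1).

countBelow : (ℕ → Bool) → ℕ → ℕ
countBelow s zero = zero
countBelow s (suc N) with s N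
... | true  = suc (countBelow s N)
... | false = countBelow s N

record State (b : ℕ) : Set where
  field
    seq    : ℕ → Bool
    finite : ∃ λ N → ((i : ℕ) → N ≤ i → seq i ≡ false) × countBelow seq N ≡ b
open State public

_≈ˢ_ : ∀ {b} → State b → State b → Set
α ≈ˢ β = (i : ℕ) → seq α i ≡ seq β i

-- transition α → β  iff  α_{i+1} ≤ β_i for all i ≥ 1
-- (0-based: seq α (suc i) ≤ seq β i, with false < true)
Transition : ∀ {b} → State b → State b → Set
Transition α β = (i : ℕ) → seq α (suc i) ≡ true → seq β i ≡ true

-- Prime juggling patterns of period n: directed cycles of length n,
-- given as an n-periodic sequence of states s 0, s 1, … with
-- s k → s (k+1), and s 0, …, s (n-1) pairwise distinct.

record PrimePattern (b n : ℕ) : Set where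
  field
    st       : ℕ → State b
    periodic : (k : ℕ) → st (k + n) ≈ˢ st k
    step     : (k : ℕ) → Transition (st k) (st (suc k))
    distinct : (i j : ℕ) → i < j → j < n → ¬ (st i ≈ˢ st j)
open PrimePattern public

SamePattern : ∀ {b n} → PrimePattern b n → PrimePattern b n → Set
SamePattern P Q = ∃ λ r → (k : ℕ) → st Q k ≈ˢ st P (k + r)

PairwiseDistinct : ∀ {b n} → List (PrimePattern b n) → Set
PairwiseDistinct = AllPairs (λ P Q → ¬ SamePattern P Q)

-- "N'(b,n) ≥ q": there are at least q pairwise different prime
-- b-ball patterns of period n (q rational)
atLeastPatterns : ℕ → ℕ → ℚ → Set
atLeastPatterns b n q =
  ∃ λ (L : List (PrimePattern b n)) → PairwiseDistinct L × q ℚ.≤ ((+ length L) ℚ./ 1)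

-- a / d as a rational; only ever used with d ≥ 1 (the d = 0 case is junk)
frac : ℕ → ℕ → ℚ
frac a zero    = ℚ.0ℚ
frac a (suc d) = (+ a) ℚ./ suc d

infixr 8 _^ℚ_
_^ℚ_ : ℚ → ℕ → ℚ
q ^ℚ zero  = ℚ.1ℚ
q ^ℚ suc k = q ℚ.* (q ^ℚ k)

sumℚ : List ℚ → ℚ
sumℚ []       = ℚ.0ℚ
sumℚ (x ∷ xs) = x ℚ.+ sumℚ xs

strictParts : ℕ → ℕ → List (List ℕ)
strictParts zero zero    = [] ∷ []
strictParts zero (suc n) = []
strictParts (suc m) n with suc m ≤ᵇ n
... | true  = strictParts m n ++ map (suc m ∷_) (strictParts m (n ∸ suc m))
... | false = strictParts m n

strictPartitions : ℕ → List (List ℕ)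
strictPartitions n = strictParts n n

prodFactor : ℕ → ℕ → List ℕ → ℚ
prodFactor b i []       = ℚ.1ℚ
prodFactor b i (p ∷ ps) =
  (frac (i + b ∸ 1) (i + b ∸ 2) ^ℚ p) ℚ.* prodFactor b (suc i) ps

summand : ℕ → ℕ → List ℕ → ℚ
summand b n ps =
  frac ((b ∸ 1) ℕ.^ n) ((length ps + b ∸ 1) C b) ℚ.* prodFactor b 1 ps

lowerBound : ℕ → ℕ → ℚ
lowerBound b n = frac 1 b ℚ.* sumℚ (map (summand b n) (nonEmpty (strictPartitions n)))
  where
  nonEmpty : List (List ℕ) → List (List ℕ)
  nonEmpty []             = []
  nonEmpty ([] ∷ xss)     = nonEmpty xss
  nonEmpty ((x ∷ xs) ∷ xss) = (x ∷ xs) ∷ nonEmpty xss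

module Submission where

-- With b = B + 1, a pattern is encoded by an n-periodic word of letters 0, …, b attached to landing
-- times: reading time backwards, letter k ≥ 1 at y says that the ball landing at y has the k-th latest
-- throwing time among the b balls in the air, and letter 0 says that no ball lands at y.  The latest
-- pending landing time of a state always carries the letter b, and the second latest one carries b or
-- b − 1 and has the latest one as the next occurrence of b.  Hence the states are distinct as soon as
-- different occurrences (mod n) of b − 1 or b have different distances to the next b.  The states
-- determine the word, because the order of the throwing times can be read off from them.
--
-- The words with this property are counted by building all blocks between consecutive b's at once,
-- column by column at decreasing distance v to the next b: if i blocks are present, either no block
-- has length v, and at most one of them gets the letter b − 1, which gives (b − 1)^(i−1) (i + b − 1)
-- columns, or v is a part, the new block is inserted after one of the i present ones, and these avoid
-- b − 1, which gives i (b − 1)^i choices.  Summed over strict partitions this is exactly the bound.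

open import Defs
open import Data.Bool using (Bool; true; false; T)
open import Data.Empty using (⊥; ⊥-elim)
open import Data.Fin using (Fin; zero; suc)
open import Data.Integer as ℤ using ()
import Data.Integer.Properties as ℤP
open import Data.List using (List; []; _∷_; _++_; map; length; drop; upTo; allFin; cartesianProduct; cartesianProductWith)
open import Data.List.Properties as ListP using (length-++; length-map; length-tabulate; length-applyUpTo; ++-assoc; ++-identityʳ; map-++; map-∘; map-cong)
open import Data.List.Membership.Propositional using (_∈_)
open import Data.List.Membership.Propositional.Properties using (∈-cartesianProductWith⁻; ∈-cartesianProduct⁻; ∈-map⁻; ∈-upTo⁻)
open import Data.List.Relation.Binary.Permutation.Propositional as ↭ using (_↭_; ↭⇒↭ₛ)
open import Data.List.Relation.Binary.Permutation.Propositional.Properties using (All-resp-↭; shift; ++⁺ˡ)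
import Data.List.Relation.Binary.Permutation.Setoid.Properties as ↭ₛ
open import Data.List.Relation.Unary.All as All using (All; []; _∷_)
import Data.List.Relation.Unary.All.Properties as AllP
open import Data.List.Relation.Unary.AllPairs as AllPairs using ([]; _∷_)
open import Data.List.Relation.Unary.Any using (here; there)
open import Data.List.Relation.Unary.Unique.Propositional using (Unique)
import Data.List.Relation.Unary.Unique.Propositional.Properties as UniqueP
open import Data.Nat
open import Data.Nat.Combinatorics.Specification using (k>n⇒nCk≡0)
open import Data.Nat.DivMod
open import Data.Nat.Properties
open import Data.Nat.Tactic.RingSolver using (solve-∀)
open import Data.Product using (∃; ∃₂; _×_; _,_; proj₁; proj₂)
open import Data.Rational as ℚ using (ℚ; 1ℚ; fromℚᵘ; toℚᵘ)
import Data.Rational.Properties as ℚP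
open import Data.Rational.Solver using (module +-*-Solver)
open import Data.Rational.Unnormalised as ℚᵘ using (mkℚᵘ; *≡*)
import Data.Rational.Unnormalised.Properties as ℚᵘP
open import Data.Sum using (_⊎_; inj₁; inj₂)
open import Data.Vec as Vec using (Vec; []; _∷_; zipWith; replicate)
import Data.Vec.Properties as VecP
open import Data.Vec.Relation.Unary.All as VAll using ([]; _∷_)
open import Function using (_∘_)
open import Relation.Binary using (tri<; tri≈; tri>)
open import Relation.Binary.PropositionalEquality
open import Relation.Nullary using (¬_; yes; no; contradiction)
open +-*-Solver using (solve; _:*_; _:=_)

-- Comparisons and counting along Boolean sequences

≤ᵇ-true⁺ : ∀ {m n} → m ≤ n → (m ≤ᵇ n) ≡ true
≤ᵇ-true⁺ {m} {n} p with m ≤ᵇ n | ≤⇒≤ᵇ p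
... | true | _ = refl

≤ᵇ-false⁺ : ∀ {m n} → n < m → (m ≤ᵇ n) ≡ false
≤ᵇ-false⁺ {m} {n} p with m ≤ᵇ n in eq
... | false = refl
... | true = contradiction (≤ᵇ⇒≤ m n (subst T (sym eq) _)) (<⇒≱ p)

≤ᵇ-true⁻ : ∀ m n → (m ≤ᵇ n) ≡ true → m ≤ n
≤ᵇ-true⁻ m n eq = ≤ᵇ⇒≤ m n (subst T (sym eq) _)

≤ᵇ-cong : ∀ {m n k l} → (m ≤ n → k ≤ l) → (k ≤ l → m ≤ n) → (m ≤ᵇ n) ≡ (k ≤ᵇ l)
≤ᵇ-cong {m} {n} {k} {l} f g with m ≤? n
... | yes p = trans (≤ᵇ-true⁺ p) (sym (≤ᵇ-true⁺ (f p)))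
... | no ¬p = trans (≤ᵇ-false⁺ (≰⇒> ¬p)) (sym (≤ᵇ-false⁺ (≰⇒> (¬p ∘ g))))

countBelow-suc-true : ∀ f N → f N ≡ true → countBelow f (suc N) ≡ suc (countBelow f N)
countBelow-suc-true f N eq rewrite eq = refl

countBelow-cong : ∀ {f g} → (∀ i → f i ≡ g i) → ∀ N → countBelow f N ≡ countBelow g N
countBelow-cong h zero = refl
countBelow-cong {f} {g} h (suc N) with f N | g N | h N
... | true  | .true  | refl = cong suc (countBelow-cong h N)
... | false | .false | refl = countBelow-cong h N

countBelow-true : ∀ f N → f 0 ≡ true → countBelow f (suc N) ≡ suc (countBelow (f ∘ suc) N)
countBelow-true f zero eq rewrite eq = refl
countBelow-true f (suc N) eq with f (suc N)
... | true  = cong suc (countBelow-true f N eq)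
... | false = countBelow-true f N eq

countBelow-false : ∀ f N → f 0 ≡ false → countBelow f (suc N) ≡ countBelow (f ∘ suc) N
countBelow-false f zero eq rewrite eq = refl
countBelow-false f (suc N) eq with f (suc N)
... | true  = cong suc (countBelow-false f N eq)
... | false = countBelow-false f N eq

countBelow-mono : ∀ f {M N} → M ≤ N → countBelow f M ≤ countBelow f N
countBelow-mono f {M} {N} M≤N = go (≤⇒≤′ M≤N)
  where
  go : ∀ {N} → M ≤′ N → countBelow f M ≤ countBelow f N
  go (≤′-reflexive refl) = ≤-refl
  go {suc N} (≤′-step p) with f N
  ... | true  = m≤n⇒m≤1+n (go p)
  ... | false = go p

countBelow-stable : ∀ f {N i} {m} → (∀ {j} → N ≤ j → countBelow f j ≡ m) → N ≤ i → f i ≡ false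
countBelow-stable f {N} {i} stable N≤i with f i in eq
... | false = refl
... | true = contradiction (trans (sym (stable (m≤n⇒m≤1+n N≤i)))
                    (trans (countBelow-suc-true f i eq) (cong suc (stable N≤i)))) (1+n≢n ∘ sym)

countBelow-1≤⇒∃ : ∀ f N → 1 ≤ countBelow f N → ∃ λ i → i < N × f i ≡ true
countBelow-1≤⇒∃ f (suc N) p with f N in eq
... | true = N , ≤-refl , eq
... | false with countBelow-1≤⇒∃ f N p
...   | i , i<N , fi = i , m<n⇒m<1+n i<N , fi

countBelow-2≤⇒∃≢ : ∀ f N → 2 ≤ countBelow f N → ∀ j → ∃ λ i → i < N × i ≢ j × f i ≡ true
countBelow-2≤⇒∃≢ f (suc N) p j with f N in eq
... | false with countBelow-2≤⇒∃≢ f N p j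
...   | i , i<N , i≢j , fi = i , m<n⇒m<1+n i<N , i≢j , fi
countBelow-2≤⇒∃≢ f (suc N) (s≤s p) j | true with N ≟ j
... | no N≢j = N , ≤-refl , N≢j , eq
... | yes refl with countBelow-1≤⇒∃ f N p
...   | i , i<N , fi = i , m<n⇒m<1+n i<N , <⇒≢ i<N , fi

last-true : ∀ (f : ℕ → Bool) N {i} → i < N → f i ≡ true →
  ∃ λ m → m < N × f m ≡ true × (∀ {j} → m < j → j < N → f j ≡ false)
last-true f (suc N) {i} i<N fi with f N in eq
... | true = N , ≤-refl , eq , λ m<j j<N → contradiction (<-≤-trans m<j (≤-pred j<N)) (<-irrefl refl)
... | false with m≤n⇒m<n∨m≡n (≤-pred i<N)
...   | inj₂ refl = contradiction (trans (sym eq) fi) λ ()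
...   | inj₁ i<N′ with last-true f N i<N′ fi
...     | m , m<N , fm , after = m , m<n⇒m<1+n m<N , fm , after′
  where
  after′ : ∀ {j} → m < j → j < suc N → f j ≡ false
  after′ m<j j<N with m≤n⇒m<n∨m≡n (≤-pred j<N)
  ... | inj₁ p = after m<j p
  ... | inj₂ refl = eq

-- Juggling cards

-- One step back across a time with letter `k`. The ball thrown there has rank 1 afterwards and was
-- not in the air before, so 1 becomes 0. Ranks from 2 to `k` drop by one, because that throw was
-- later. Ranks above `k` were also above the landing ball and stay. For `k = 0` nothing changes.
dropLevel : ℕ → ℕ → ℕ
dropLevel k l with l ≤? k
... | yes _ = pred l
... | no  _ = l

dropLevel-above : ∀ {k l} → k < l → dropLevel k l ≡ l
dropLevel-above {k} {l} p with l ≤? k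
... | yes q = contradiction q (<⇒≱ p)
... | no _ = refl

dropLevel-≤ : ∀ k l → dropLevel k l ≤ l
dropLevel-≤ k l with l ≤? k
... | yes _ = pred[n]≤n
... | no  _ = ≤-refl

dropLevel-strict : ∀ k {l l′} → 1 ≤ l → l < l′ → dropLevel k l < dropLevel k l′
dropLevel-strict k {l} {l′} 1≤l l<l′ with l ≤? k | l′ ≤? k
... | yes _ | yes _ = pred-mono-< {{>-nonZero 1≤l}} l<l′
... | yes _ | no  _ = ≤-<-trans pred[n]≤n l<l′
... | no p  | yes q = contradiction (≤-trans (<⇒≤ l<l′) q) p
... | no _  | no  _ = l<l′

dropLevel-mono : ∀ k {l l′} → l ≤ l′ → dropLevel k l ≤ dropLevel k l′
dropLevel-mono k {zero} _ = ≤-trans (dropLevel-≤ k 0) z≤n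
dropLevel-mono k {suc l} p with m≤n⇒m<n∨m≡n p
... | inj₁ q = <⇒≤ (dropLevel-strict k (s≤s z≤n) q)
... | inj₂ refl = ≤-refl

dropLevel-≤ᵇ-below : ∀ {k ℓ} l → 1 ≤ ℓ → ℓ ≤ k → (ℓ ≤ᵇ dropLevel k l) ≡ (suc ℓ ≤ᵇ l)
dropLevel-≤ᵇ-below {k} {ℓ} l 1≤ℓ ℓ≤k with l ≤? k
dropLevel-≤ᵇ-below {k} {suc ℓ} zero 1≤ℓ ℓ≤k | yes _ = refl
dropLevel-≤ᵇ-below {k} {ℓ} (suc l) 1≤ℓ ℓ≤k | yes _ = ≤ᵇ-cong {ℓ} {l} {suc ℓ} {suc l} s≤s ≤-pred
... | no ¬p = ≤ᵇ-cong (λ _ → ≤-<-trans ℓ≤k (≰⇒> ¬p)) (λ q → <⇒≤ q)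

dropLevel-≤ᵇ-above : ∀ {k ℓ} l → k < ℓ → (ℓ ≤ᵇ dropLevel k l) ≡ (ℓ ≤ᵇ l)
dropLevel-≤ᵇ-above {k} {ℓ} l k<ℓ with l ≤? k
... | yes p = ≤ᵇ-cong (λ q → ≤-trans q pred[n]≤n) (λ q → contradiction (≤-trans q p) (<⇒≱ k<ℓ))
... | no _ = refl

module Levels (c : ℕ → ℕ) where

  -- Rank of the throwing time of the ball landing at s + i among the throws before time s,
  -- latest first; 0 if that ball is not in the air just before time s.
  lev : ℕ → ℕ → ℕ
  lev s zero    = c s
  lev s (suc i) = dropLevel (c s) (lev (suc s) i)

  lev-≤ : ∀ {b} → (∀ s → c s ≤ b) → ∀ s i → lev s i ≤ b
  lev-≤ c≤b s zero    = c≤b s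
  lev-≤ c≤b s (suc i) = ≤-trans (dropLevel-≤ (c s) _) (lev-≤ c≤b (suc s) i)

  -- Going back in time never reverses the throwing order, since each `dropLevel` is monotone. The
  -- strict version below needs a positive level, because both 0 and 1 can be sent to 0.
  lev-mono : ∀ k s {i j} → lev (k + s) i ≤ lev (k + s) j → lev s (k + i) ≤ lev s (k + j)
  lev-mono zero    s p = p
  lev-mono (suc k) s {i} {j} p = dropLevel-mono (c s) (lev-mono k (suc s)
    (subst (λ z → lev z i ≤ lev z j) (sym (+-suc k s)) p))

  lev-strict : ∀ k s {i j} → 1 ≤ lev s (k + i) → lev (k + s) i < lev (k + s) j → lev s (k + i) < lev s (k + j)
  lev-strict zero    s _ p = p
  lev-strict (suc k) s {i} {j} 1≤ p = dropLevel-strict (c s) 1≤′ (lev-strict k (suc s) 1≤′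
    (subst (λ z → lev z i < lev z j) (sym (+-suc k s)) p))
    where
    1≤′ : 1 ≤ lev (suc s) (k + i)
    1≤′ = ≤-trans 1≤ (dropLevel-≤ (c s) _)

  -- Letters below `b` leave level `b` fixed, so the next occurrence of `b` already has level `b` as
  -- seen from `s`.
  lev-quiet : ∀ {b} i s → (∀ j → j < i → c (j + s) < b) → c (i + s) ≡ b → lev s i ≡ b
  lev-quiet zero s q r = r
  lev-quiet {b} (suc i) s q r rewrite lev-quiet {b} i (suc s)
      (λ j j<i → subst (λ z → c z < b) (sym (+-suc j s)) (q (suc j) (s≤s j<i)))
      (trans (cong c (+-suc i s)) r) = dropLevel-above (q 0 (s≤s z≤n))

lev-cong : ∀ {c d : ℕ → ℕ} r → (∀ s → d s ≡ c (s + r)) → ∀ s i → Levels.lev d s i ≡ Levels.lev c (s + r) i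
lev-cong r h s zero = h s
lev-cong r h s (suc i) = cong₂ dropLevel (h s) (lev-cong r h (suc s) i)

record Cards (b : ℕ) : Set where
  field
    card    : ℕ → ℕ
    card≤   : ∀ s → card s ≤ b
    recurs  : ∀ s → ∃ λ i → card (i + s) ≡ b
  open Levels card public

  isTop : ℕ → ℕ → Bool
  isTop s i = b ≤ᵇ card (i + s)

  tops : ∀ j s → ∃ λ N → ∀ {m} → N ≤ m → j ≤ countBelow (isTop s) m
  tops zero s = 0 , λ _ → z≤n
  tops (suc j) s with tops j s
  ... | N , h with recurs (N + s)
  ...   | i , eq = suc (i + N) , λ p → ≤-trans
          (≤-trans (s≤s (h (m≤n+m N i)))
            (≤-reflexive (sym (countBelow-suc-true (isTop s) (i + N) (≤ᵇ-true⁺ (≤-reflexive (sym (trans (cong card (+-assoc i N s)) eq))))))))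
          (countBelow-mono (isTop s) p)

  -- Each rank from `ℓ` to `b` belongs to exactly one ball. Moving `s` forward, a letter at least
  -- `ℓ` is counted and leaves the ranks from `ℓ + 1` on, while a smaller letter leaves all ranks
  -- from `ℓ` on untouched. The window contains at least `j` tops, so it cannot end before `j` has
  -- reached 0.
  level-count : ∀ m s ℓ j → 1 ≤ ℓ → ℓ + j ≡ suc b → j ≤ countBelow (isTop s) m →
    countBelow (λ i → ℓ ≤ᵇ lev s i) m ≡ j
  level-count zero s ℓ j _ _ p = sym (n≤0⇒n≡0 p)
  level-count (suc m) s ℓ j 1≤ℓ eq p with ℓ ≤? card s
  -- For `j = 0` the level `ℓ` is `b + 1`, above every letter.
  level-count (suc m) s ℓ zero 1≤ℓ eq p | yes q =
    contradiction (≤-trans q (card≤ s)) (<⇒≱ (≤-reflexive (trans (sym eq) (+-identityʳ ℓ))))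
  level-count (suc m) s ℓ (suc j) 1≤ℓ eq p | yes q = begin
    countBelow (λ i → ℓ ≤ᵇ lev s i) (suc m)
      ≡⟨ countBelow-true (λ i → ℓ ≤ᵇ lev s i) m (≤ᵇ-true⁺ q) ⟩
    suc (countBelow (λ i → ℓ ≤ᵇ dropLevel (card s) (lev (suc s) i)) m)
      ≡⟨ cong suc (countBelow-cong (λ i → dropLevel-≤ᵇ-below (lev (suc s) i) 1≤ℓ q) m) ⟩
    suc (countBelow (λ i → suc ℓ ≤ᵇ lev (suc s) i) m)
      ≡⟨ cong suc (level-count m (suc s) (suc ℓ) j (s≤s z≤n) (trans (sym (+-suc ℓ j)) eq) (fewer p)) ⟩
    suc j ∎
    where
    open ≡-Reasoning
    fewer : suc j ≤ countBelow (isTop s) (suc m) → j ≤ countBelow (isTop (suc s)) m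
    fewer h with isTop s 0 in e
    ... | true  = ≤-pred (≤-trans h (≤-reflexive (trans (countBelow-true (isTop s) m e)
                   (cong suc (countBelow-cong (λ i → cong (λ z → b ≤ᵇ card z) (sym (+-suc i s))) m)))))
    ... | false = ≤-trans (n≤1+n j) (≤-trans h (≤-reflexive (trans (countBelow-false (isTop s) m e)
                   (countBelow-cong (λ i → cong (λ z → b ≤ᵇ card z) (sym (+-suc i s))) m))))
  level-count (suc m) s ℓ j 1≤ℓ eq p | no q = begin
    countBelow (λ i → ℓ ≤ᵇ lev s i) (suc m)
      ≡⟨ countBelow-false (λ i → ℓ ≤ᵇ lev s i) m (≤ᵇ-false⁺ (≰⇒> q)) ⟩
    countBelow (λ i → ℓ ≤ᵇ dropLevel (card s) (lev (suc s) i)) m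
      ≡⟨ countBelow-cong (λ i → dropLevel-≤ᵇ-above (lev (suc s) i) (≰⇒> q)) m ⟩
    countBelow (λ i → ℓ ≤ᵇ lev (suc s) i) m
      ≡⟨ level-count m (suc s) ℓ j 1≤ℓ eq (same j eq p) ⟩
    j ∎
    where
    open ≡-Reasoning
    same : ∀ j → ℓ + j ≡ suc b → j ≤ countBelow (isTop s) (suc m) → j ≤ countBelow (isTop (suc s)) m
    same zero _ _ = z≤n
    -- A positive `j` forces `ℓ ≤ b`, so the letter at `s`, being below `ℓ`, is not a top and the
    -- shorter window has as many tops.
    same (suc j) eq h = ≤-trans h (≤-reflexive (trans (countBelow-false (isTop s) m
        (≤ᵇ-false⁺ (<-≤-trans (≰⇒> q) (≤-trans (m≤m+n ℓ j) (≤-reflexive (suc-injective (trans (sym (+-suc ℓ j)) eq)))))))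
        (countBelow-cong (λ i → cong (λ z → b ≤ᵇ card z) (sym (+-suc i s))) m)))

  level-count-eventually : ∀ s ℓ j → 1 ≤ ℓ → ℓ + j ≡ suc b →
    ∃ λ N → ∀ {m} → N ≤ m → countBelow (λ i → ℓ ≤ᵇ lev s i) m ≡ j
  level-count-eventually s ℓ j 1≤ℓ eq with tops j s
  ... | N , h = N , λ {m} p → level-count m s ℓ j 1≤ℓ eq (h p)

  pending : ℕ → ℕ → Bool
  pending s i = 1 ≤ᵇ lev s i

  state : ℕ → State b
  state s = record { seq = pending s ; finite = proj₁ ev , (λ i → countBelow-stable (pending s) (λ {j} → proj₂ ev {j})) , proj₂ ev ≤-refl }
    where
    ev : ∃ λ N → ∀ {m} → N ≤ m → countBelow (pending s) m ≡ b
    ev = level-count-eventually s 1 b ≤-refl refl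

  state-transition : ∀ s → Transition (state s) (state (suc s))
  state-transition s i p = ≤ᵇ-true⁺ (≤-trans (≤ᵇ-true⁻ 1 (lev s (suc i)) p) (dropLevel-≤ (card s) (lev (suc s) i)))

  -- A larger level means an earlier throw: if a ball is in the air at time `s`, so is every ball
  -- thrown before it. All information about letters is extracted from states through this.
  pending-mono : ∀ k s {i j} → lev (k + s) i ≤ lev (k + s) j → pending s (k + i) ≡ true → pending s (k + j) ≡ true
  pending-mono k s {i} le p = ≤ᵇ-true⁺ (≤-trans (≤ᵇ-true⁻ 1 (lev s (k + i)) p) (lev-mono k s le))

-- The two latest pending landing times and the distinctness of states

first-true : ∀ (f : ℕ → Bool) i → f i ≡ true → ∃ λ m → f m ≡ true × (∀ {j} → j < m → f j ≡ false)
first-true f i fi with f 0 in eq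
... | true = 0 , eq , λ ()
first-true f zero fi | false = contradiction (trans (sym eq) fi) λ ()
first-true f (suc i) fi | false with first-true (f ∘ suc) i fi
... | m , fm , before = suc m , fm , λ { {zero} _ → eq ; {suc j} (s≤s p) → before p }

true≢false : ∀ {x : Bool} → x ≡ true → x ≡ false → ⊥
true≢false p q = contradiction (trans (sym p) q) λ ()

[q+d]+s≡d+[q+s] : ∀ q d s → (q + d) + s ≡ d + (q + s)
[q+d]+s≡d+[q+s] q d s = trans (cong (_+ s) (+-comm q d)) (+-assoc d q s)

module _ {b : ℕ} (C : Cards b) where
  open Cards C

  record NextTop (s e : ℕ) : Set where
    field
      positive : 1 ≤ e
      top      : card (e + s) ≡ b
      none     : ∀ {j} → 1 ≤ j → j < e → card (j + s) ≢ b

  nextTop : ∀ s → ∃ λ e → NextTop s e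
  nextTop s with recurs (suc s)
  ... | i , eq with first-true (isTop (suc s)) i (≤ᵇ-true⁺ (≤-reflexive (sym eq)))
  ...   | m , fm , before = suc m , record
    { positive = s≤s z≤n
    ; top      = trans (cong card (sym (+-suc m s))) (≤-antisym (card≤ _) (≤ᵇ-true⁻ b _ fm))
    ; none     = λ { {suc j} _ (s≤s p) eq → true≢false
                       (≤ᵇ-true⁺ (≤-reflexive (sym (trans (cong card (+-suc j s)) eq)))) (before p) } }

  -- Otherwise the next top after `M` has the maximal level `b` as seen from `M`, so it is pending
  -- together with `M`, although it is later.
  last-pending-top : ∀ s M → pending s M ≡ true → (∀ {j} → M < j → pending s j ≡ false) → card (M + s) ≡ b
  last-pending-top s M pM above with m≤n⇒m<n∨m≡n (card≤ (M + s))
  ... | inj₂ eq = eq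
  ... | inj₁ c<b with nextTop (M + s)
  ...   | e , nt = ⊥-elim (true≢false
          (pending-mono M s {0} {e} (≤-trans (card≤ _) (≤-reflexive (sym full)))
            (trans (cong (pending s) (+-identityʳ M)) pM))
          (above (m<m+n M (NextTop.positive nt))))
    where
    full : lev (M + s) e ≡ b
    full = lev-quiet e (M + s)
      (λ { zero _ → c<b ; (suc j) p → ≤∧≢⇒< (card≤ _) (NextTop.none nt (s≤s z≤n) p) })
      (NextTop.top nt)

  -- A top strictly between `Q` and `Q + d` would have maximal level as seen from its own time, at
  -- least that of the pending `Q + d`, so it would be pending too.
  second-pending-nextTop : ∀ s Q d → 1 ≤ d → pending s (Q + d) ≡ true → card ((Q + d) + s) ≡ b →
    (∀ {j} → Q < j → j < Q + d → pending s j ≡ false) → NextTop (Q + s) d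
  second-pending-nextTop s Q d 1≤d pM cM between with nextTop (Q + s)
  ... | e , nt with <-cmp e d
  ...   | tri≈ _ refl _ = nt
  ...   | tri> _ _ d<e = ⊥-elim (NextTop.none nt 1≤d d<e (trans (cong card (sym ([q+d]+s≡d+[q+s] Q d s))) cM))
  ...   | tri< e<d _ _ = ⊥-elim (true≢false
          (trans (cong (pending s) (sym (+-identityʳ (Q + e))))
            (pending-mono (Q + e) s {d ∸ e} {0}
              (≤-trans (lev-≤ card≤ _ (d ∸ e)) (≤-reflexive (sym (trans (cong card ([q+d]+s≡d+[q+s] Q e s)) (NextTop.top nt)))))
              (trans (cong (pending s) (trans (+-assoc Q e (d ∸ e)) (cong (Q +_) (m+[n∸m]≡n (<⇒≤ e<d))))) pM)))
          (between (m<m+n Q (NextTop.positive nt)) (+-monoʳ-< Q e<d)))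

module _ {B : ℕ} (1≤B : 1 ≤ B) (C : Cards (suc B)) where
  open Cards C

  -- Seen from `Q`, exactly two landing times have level at least `B`. If `Q` had a smaller letter,
  -- it would be neither of them, and both would be pending with `Q`; but only `Q + d` is pending
  -- after `Q`.
  second-pending-high : ∀ s Q d → pending s Q ≡ true →
    (∀ {j} → Q < j → j < Q + d → pending s j ≡ false) → (∀ {j} → Q + d < j → pending s j ≡ false) →
    B ≤ card (Q + s)
  second-pending-high s Q d pQ between above with B ≤? card (Q + s)
  ... | yes p = p
  ... | no ¬p with level-count-eventually (Q + s) B 2 1≤B (+-comm B 2)
  ...   | N , h with countBelow-2≤⇒∃≢ _ N (≤-reflexive (sym (h ≤-refl))) d
  ...     | zero , _ , _ , fy = contradiction (≤ᵇ-true⁻ B _ fy) ¬p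
  ...     | y@(suc _) , _ , y≢d , fy = ⊥-elim (absurd (<-cmp (Q + y) (Q + d)))
    where
    pending-y : pending s (Q + y) ≡ true
    pending-y = pending-mono Q s {0} {y} (≤-trans (<⇒≤ (≰⇒> ¬p)) (≤ᵇ-true⁻ B _ fy))
      (trans (cong (pending s) (+-identityʳ Q)) pQ)
    absurd : _ → ⊥
    absurd (tri< lt _ _) = true≢false pending-y (between (m<m+n Q (s≤s z≤n)) lt)
    absurd (tri≈ _ eq _) = y≢d (+-cancelˡ-≡ Q _ _ eq)
    absurd (tri> _ _ gt) = true≢false pending-y (above gt)

  record TopTwo (s Q d : ℕ) : Set where
    field
      1≤d       : 1 ≤ d
      pending-Q : pending s Q ≡ true
      pending-M : pending s (Q + d) ≡ true
      between   : ∀ {j} → Q < j → j < Q + d → pending s j ≡ false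
      above     : ∀ {j} → Q + d < j → pending s j ≡ false

  topTwo : ∀ s → ∃₂ (TopTwo s)
  topTwo s with finite (state s)
  ... | N , beyond , count with countBelow-1≤⇒∃ (pending s) N (≤-trans (s≤s z≤n) (≤-reflexive (sym count)))
  ... | i , i<N , pi with last-true (pending s) N i<N pi
  ... | M , M<N , pM , aboveN with countBelow-2≤⇒∃≢ (pending s) N (≤-trans (s≤s 1≤B) (≤-reflexive (sym count))) M
  ... | j , j<N , j≢M , pj with <-cmp j M
  ... | tri≈ _ eq _ = contradiction eq j≢M
  ... | tri> _ _ gt = ⊥-elim (true≢false pj (aboveN gt j<N))
  ... | tri< lt _ _ with last-true (pending s) M lt pj
  ... | Q , Q<M , pQ , between = Q , M ∸ Q , record
    { 1≤d = m<n⇒0<n∸m Q<M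
    ; pending-Q = pQ
    ; pending-M = trans (cong (pending s) Q+d≡M) pM
    ; between = λ p q → between p (<-≤-trans q (≤-reflexive Q+d≡M))
    ; above = λ {k} p → above (≤-<-trans (≤-reflexive (sym Q+d≡M)) p) }
    where
    Q+d≡M : Q + (M ∸ Q) ≡ M
    Q+d≡M = m+[n∸m]≡n (<⇒≤ Q<M)
    above : ∀ {k} → M < k → pending s k ≡ false
    above {k} p with k <? N
    ... | yes q = aboveN p q
    ... | no ¬q = beyond k (≮⇒≥ ¬q)

  topTwo-unique : ∀ {s s′ Q d Q′ d′} → (∀ i → pending s i ≡ pending s′ i) →
    TopTwo s Q d → TopTwo s′ Q′ d′ → Q ≡ Q′ × d ≡ d′
  topTwo-unique {s} {s′} {Q} {d} {Q′} {d′} eq T T′ = Q≡ , +-cancelˡ-≡ Q _ _ (trans M≡ (cong (_+ d′) (sym Q≡)))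
    where
    module T = TopTwo T
    module T′ = TopTwo T′
    M≡ : Q + d ≡ Q′ + d′
    M≡ with <-cmp (Q + d) (Q′ + d′)
    ... | tri≈ _ p _ = p
    ... | tri< p _ _ = ⊥-elim (true≢false T′.pending-M (trans (sym (eq (Q′ + d′))) (T.above p)))
    ... | tri> _ _ p = ⊥-elim (true≢false T.pending-M (trans (eq (Q + d)) (T′.above p)))
    Q≡ : Q ≡ Q′
    Q≡ with <-cmp Q Q′
    ... | tri≈ _ p _ = p
    ... | tri< p _ _ = ⊥-elim (true≢false T′.pending-Q (trans (sym (eq Q′))
            (T.between p (<-≤-trans (m<m+n Q′ T′.1≤d) (≤-reflexive (sym M≡))))))
    ... | tri> _ _ p = ⊥-elim (true≢false T.pending-Q (trans (eq Q)
            (T′.between p (<-≤-trans (m<m+n Q T.1≤d) (≤-reflexive M≡)))))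

  topTwo-nextTop : ∀ {s Q d} → TopTwo s Q d → NextTop C (Q + s) d
  topTwo-nextTop {s} {Q} {d} T = second-pending-nextTop C s Q d 1≤d pending-M
    (last-pending-top C s (Q + d) pending-M above) between
    where open TopTwo T

  InjectiveGaps : (n : ℕ) .{{_ : NonZero n}} → Set
  InjectiveGaps n = ∀ {τ τ′ e} → B ≤ card τ → B ≤ card τ′ → NextTop C τ e → NextTop C τ′ e → τ % n ≡ τ′ % n

  -- Equal states share `Q` and `d`. The letters at `Q + i` and `Q + j` are then both at least `B`
  -- with the same distance `d` to the next top, so these times agree mod `n`, and hence so do `i`
  -- and `j`.
  states-distinct : ∀ n .{{_ : NonZero n}} → InjectiveGaps n →
    ∀ i j → i < j → j < n → ¬ (state i ≈ˢ state j)
  states-distinct n inj i j i<j j<n eq with topTwo i | topTwo j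
  ... | Q , d , T | Q′ , d′ , T′ with topTwo-unique eq T T′
  ... | refl , refl = <⇒≢ i<j (begin
    i                            ≡⟨ m<n⇒m%n≡m (<-trans i<j j<n) ⟨
    -- To avoid subtracting `Q`, each side receives the multiple of `n` contained in the other sum;
    -- `shifted` makes the results equal.
    i % n                        ≡⟨ [m+kn]%n≡m%n i ((Q + j) / n) n ⟨
    (i + (Q + j) / n * n) % n    ≡⟨ cong (_% n) shifted ⟩
    (j + (Q + i) / n * n) % n    ≡⟨ [m+kn]%n≡m%n j ((Q + i) / n) n ⟩
    j % n                        ≡⟨ m<n⇒m%n≡m j<n ⟩
    j ∎)
    where
    open ≡-Reasoning
    r≡ : (Q + i) % n ≡ (Q + j) % n
    r≡ = inj (second-pending-high i Q d T.pending-Q T.between T.above)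
             (second-pending-high j Q d T′.pending-Q T′.between T′.above)
             (topTwo-nextTop T) (topTwo-nextTop T′)
      where
      module T = TopTwo T
      module T′ = TopTwo T′
    shifted : i + (Q + j) / n * n ≡ j + (Q + i) / n * n
    shifted = +-cancelˡ-≡ (Q + (Q + i) % n) _ _ (begin
      Q + (Q + i) % n + (i + (Q + j) / n * n)
        ≡⟨ regroup Q ((Q + i) % n) i ((Q + j) / n * n) ⟩
      (Q + i) + ((Q + i) % n + (Q + j) / n * n)
        ≡⟨ cong₂ _+_ (m≡m%n+[m/n]*n (Q + i) n) (cong (_+ (Q + j) / n * n) r≡) ⟩
      ((Q + i) % n + (Q + i) / n * n) + ((Q + j) % n + (Q + j) / n * n)
        ≡⟨ cong (((Q + i) % n + (Q + i) / n * n) +_) (m≡m%n+[m/n]*n (Q + j) n) ⟨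
      ((Q + i) % n + (Q + i) / n * n) + (Q + j)
        ≡⟨ regroup′ ((Q + i) % n) ((Q + i) / n * n) Q j ⟩
      Q + (Q + i) % n + (j + (Q + i) / n * n) ∎)
      where
      regroup : ∀ q r i x → q + r + (i + x) ≡ (q + i) + (r + x)
      regroup = solve-∀
      regroup′ : ∀ r x q j → (r + x) + (q + j) ≡ q + r + (j + x)
      regroup′ = solve-∀

-- Recovering the word from the states

module _ {b : ℕ} (C D : Cards b) (same : ∀ s i → Cards.pending C s i ≡ Cards.pending D s i) where
  private
    module C = Cards C
    module D = Cards D

  -- Levels are ordered by throwing time, and throwing times are visible in the states.
  level-order : ∀ k s i j → 1 ≤ C.lev (k + s) i → C.lev (k + s) i < C.lev (k + s) j →
    C.lev s (k + i) ≡ 0 → D.lev (k + s) i < D.lev (k + s) j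
  level-order zero s i j 1≤ lt z = contradiction (subst (1 ≤_) z 1≤) λ ()
  level-order (suc k) s i j 1≤ lt z with 1 ≤? C.lev (suc s) (k + i)
  ... | no ¬p = subst (λ q → D.lev q i < D.lev q j) (+-suc k s)
        (level-order k (suc s) i j (subst (λ q → 1 ≤ C.lev q i) (sym (+-suc k s)) 1≤)
          (subst (λ q → C.lev q i < C.lev q j) (sym (+-suc k s)) lt) (n≤0⇒n≡0 (≤-pred (≰⇒> ¬p))))
  -- Now `s` is the time at which `C` throws the ball landing at `i`. Just before it, the ball
  -- landing at `j` is in the air and the other is not. The opposite order in `D` would contradict
  -- this common state.
  ... | yes p = ≰⇒> λ le → true≢false
        (D.pending-mono (suc k) s {j} {i} le (trans (sym (same s (suc k + j))) (≤ᵇ-true⁺ alive)))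
        (trans (sym (same s (suc k + i))) (cong (1 ≤ᵇ_) z))
    where
    alive : 1 ≤ C.lev s (suc k + j)
    alive = ≤-<-trans z≤n (dropLevel-strict (C.card s) p (C.lev-strict k (suc s) p
      (subst (λ q → C.lev q i < C.lev q j) (sym (+-suc k s)) lt)))

  -- From time `N` on, every ball in the air was thrown at time 0 or later, so its throw lies within
  -- the range where the states are compared.
  level-order-late : ∀ {N} → (∀ i → N ≤ i → C.pending 0 i ≡ false) → ∀ s i j → N ≤ s →
    1 ≤ C.lev s i → C.lev s i < C.lev s j → D.lev s i < D.lev s j
  level-order-late dead s i j N≤s 1≤ lt = subst (λ q → D.lev q i < D.lev q j) (+-identityʳ s)
    (level-order s 0 i j (subst (λ q → 1 ≤ C.lev q i) (sym (+-identityʳ s)) 1≤)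
      (subst (λ q → C.lev q i < C.lev q j) (sym (+-identityʳ s)) lt)
      (n≤0⇒n≡0 (≮⇒≥ λ z → true≢false (≤ᵇ-true⁺ z) (dead (s + i) (≤-trans N≤s (m≤m+n s i))))))

module _ {b n : ℕ} (C D : Cards b) (same : ∀ s i → Cards.pending C s i ≡ Cards.pending D s i) where
  private
    module C = Cards C
    module D = Cards D
    same′ : ∀ s i → D.pending s i ≡ C.pending s i
    same′ s i = sym (same s i)

  -- Both families order the pending landings alike, so equally many landings have at least the
  -- level of `i`. By `level-count` this number is `b + 1` minus that level.
  levels-agree : ∀ {N} → (∀ i → N ≤ i → C.pending 0 i ≡ false) → ∀ s i → N ≤ s → C.lev s i ≡ D.lev s i
  levels-agree {N} dead s i N≤s with 1 ≤? C.lev s i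
  ... | no ¬p = trans (n≤0⇒n≡0 (≤-pred (≰⇒> ¬p))) (sym (n≤0⇒n≡0 (≤-pred (≰⇒> λ q → ¬p
                  (≤ᵇ-true⁻ 1 _ (trans (same s i) (≤ᵇ-true⁺ q)))))))
  ... | yes p = +-cancelʳ-≡ (suc b ∸ C.lev s i) (C.lev s i) (D.lev s i)
      (trans (m+[n∸m]≡n C≤) (trans (sym (m+[n∸m]≡n D≤)) (cong (D.lev s i +_) (sym counts))))
    where
    q : 1 ≤ D.lev s i
    q = ≤ᵇ-true⁻ 1 _ (trans (same′ s i) (≤ᵇ-true⁺ p))
    C≤ : C.lev s i ≤ suc b
    C≤ = m≤n⇒m≤1+n (C.lev-≤ C.card≤ s i)
    D≤ : D.lev s i ≤ suc b
    D≤ = m≤n⇒m≤1+n (D.lev-≤ D.card≤ s i)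

    dead′ : ∀ i → N ≤ i → D.pending 0 i ≡ false
    dead′ i N≤i = trans (same′ 0 i) (dead i N≤i)

    agree : ∀ j → (C.lev s i ≤ᵇ C.lev s j) ≡ (D.lev s i ≤ᵇ D.lev s j)
    agree j = ≤ᵇ-cong {C.lev s i} {C.lev s j} {D.lev s i} {D.lev s j}
      (λ le → ≮⇒≥ λ lt → <⇒≱ (level-order-late D C same′ dead′ s j i N≤s (≤ᵇ-true⁻ 1 _ (trans (same′ s j) (≤ᵇ-true⁺ (≤-trans p le)))) lt) le)
      (λ le → ≮⇒≥ λ lt → <⇒≱ (level-order-late C D same dead s j i N≤s (≤ᵇ-true⁻ 1 _ (trans (same s j) (≤ᵇ-true⁺ (≤-trans q le)))) lt) le)

    counts : suc b ∸ C.lev s i ≡ suc b ∸ D.lev s i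
    counts with C.level-count-eventually s (C.lev s i) (suc b ∸ C.lev s i) p (m+[n∸m]≡n C≤)
              | D.level-count-eventually s (D.lev s i) (suc b ∸ D.lev s i) q (m+[n∸m]≡n D≤)
    ... | N₁ , h₁ | N₂ , h₂ = trans (sym (h₁ (m≤m⊔n N₁ N₂)))
      (trans (countBelow-cong agree (N₁ ⊔ N₂)) (h₂ (m≤n⊔m N₁ N₂)))

  cards-agree : .{{_ : NonZero n}} → (∀ s k → C.card (s + k * n) ≡ C.card s) → (∀ s k → D.card (s + k * n) ≡ D.card s) →
    ∀ s → C.card s ≡ D.card s
  cards-agree C-per D-per s with finite (C.state 0)
  -- The letter is the level at distance 0, and `N` whole periods carry `s` beyond `N`.
  ... | N , dead , _ = trans (sym (C-per s N)) (trans (levels-agree dead (s + N * n) 0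
          (≤-trans (m≤m*n N n) (m≤n+m (N * n) s))) (D-per s N))

-- Words enumerating the patterns

private
  variable
    X Y Z : Set

length-cartesianProductWith : ∀ (f : X → Y → Z) xs ys →
  length (cartesianProductWith f xs ys) ≡ length xs * length ys
length-cartesianProductWith f [] ys = refl
length-cartesianProductWith f (x ∷ xs) ys = trans (length-++ (map (f x) ys))
  (cong₂ _+_ (length-map (f x) ys) (length-cartesianProductWith f xs ys))

Unique-map∈ : ∀ (f : X → Y) {xs} → (∀ {x x′} → x ∈ xs → x′ ∈ xs → f x ≡ f x′ → x ≡ x′) → Unique xs → Unique (map f xs)
Unique-map∈ f {[]} inj [] = []
Unique-map∈ f {x ∷ xs} inj (x∉ ∷ u) =
  AllP.map⁺ (All.tabulate λ x′∈ eq → All.lookup x∉ x′∈ (inj (here refl) (there x′∈) eq)) ∷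
  Unique-map∈ f (λ p q → inj (there p) (there q)) u

-- Injectivity is asked only for second arguments from the list, because `grow` is injective only on
-- vectors of tails.
Unique-cartesianProductWith∈ : ∀ (f : X → Y → Z) {xs ys} →
  (∀ {x x′ y y′} → y ∈ ys → y′ ∈ ys → f x y ≡ f x′ y′ → x ≡ x′ × y ≡ y′) →
  Unique xs → Unique ys → Unique (cartesianProductWith f xs ys)
Unique-cartesianProductWith∈ f {[]} inj [] uy = []
Unique-cartesianProductWith∈ f {x ∷ xs} {ys} inj (x∉ ∷ ux) uy =
  UniqueP.++⁺ (Unique-map∈ (f x) (λ p q eq → proj₂ (inj p q eq)) uy) (Unique-cartesianProductWith∈ f inj ux uy)
    λ { (p , q) → disjoint (∈-map⁻ (f x) p) (∈-cartesianProductWith⁻ f xs ys q) }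
  where
  disjoint : ∀ {v} → (∃ λ y → y ∈ ys × v ≡ f x y) → (∃₂ λ x′ y → x′ ∈ xs × y ∈ ys × v ≡ f x′ y) → ⊥
  disjoint (y , y∈ , refl) (x′ , y′ , x′∈ , y′∈ , eq) with inj y∈ y′∈ eq
  ... | refl , _ = All.lookup x∉ x′∈ refl

zipWith-∷-injective : ∀ {n} (x x′ : Vec X n) (ts ts′ : Vec (List X) n) → zipWith List._∷_ x ts ≡ zipWith List._∷_ x′ ts′ → x ≡ x′ × ts ≡ ts′
zipWith-∷-injective [] [] [] [] _ = refl , refl
zipWith-∷-injective (x ∷ xs) (x′ ∷ xs′) (t ∷ ts) (t′ ∷ ts′) eq with VecP.∷-injective eq
... | eq₁ , eq₂ with ListP.∷-injective eq₁ | zipWith-∷-injective xs xs′ ts ts′ eq₂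
... | refl , refl | refl , refl = refl , refl

module Words (B : ℕ) where

  -- The list starts with `r` letters other than the top letter. Every block after them, counted
  -- with its opening `suc B`, has length at most `v`.
  data Tail (v : ℕ) : ℕ → List ℕ → Set where
    []  : Tail v 0 []
    top : ∀ {r a} → r < v → Tail v r a → Tail v 0 (suc B ∷ a)
    low : ∀ {r a x} → x ≤ B → Tail v r a → Tail v (suc r) (x ∷ a)

  Tail-weaken : ∀ {v r a} → Tail v r a → Tail (suc v) r a
  Tail-weaken [] = []
  Tail-weaken (top r<v t) = top (m<n⇒m<1+n r<v) (Tail-weaken t)
  Tail-weaken (low x≤B t) = low x≤B (Tail-weaken t)

  Tail-++ : ∀ {v r s a c} → Tail v r a → s < v → Tail v s c → Tail v r (a ++ suc B ∷ c)
  Tail-++ [] s<v u = top s<v u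
  Tail-++ (top r<v t) s<v u = top r<v (Tail-++ t s<v u)
  Tail-++ (low x≤B t) s<v u = low x≤B (Tail-++ t s<v u)

  Tail-letters : ∀ {v r a} → Tail v r a → All (_≤ suc B) a
  Tail-letters [] = []
  Tail-letters (top _ t) = ≤-refl ∷ Tail-letters t
  Tail-letters (low x≤B t) = m≤n⇒m≤1+n x≤B ∷ Tail-letters t

  -- The end of the list counts as a top, since a further `suc B` follows there: the next block's
  -- opening letter, or the first letter of the next period.
  dist : List ℕ → ℕ
  dist [] = 0
  dist (x ∷ a) with x ≟ suc B
  ... | yes _ = 0
  ... | no  _ = suc (dist a)

  dist-top : ∀ a → dist (suc B ∷ a) ≡ 0
  dist-top a with suc B ≟ suc B
  ... | yes _ = refl
  ... | no ¬p = contradiction refl ¬p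

  dist-low : ∀ {x} a → x ≢ suc B → dist (x ∷ a) ≡ suc (dist a)
  dist-low {x} a x≢ with x ≟ suc B
  ... | yes p = contradiction p x≢
  ... | no _  = refl

  dist-++ : ∀ a c → dist (a ++ suc B ∷ c) ≡ dist a
  dist-++ [] c = dist-top c
  dist-++ (x ∷ a) c with x ≟ suc B
  ... | yes _ = refl
  ... | no  _ = cong suc (dist-++ a c)

  Tail-dist : ∀ {v r a} → Tail v r a → dist a ≡ r
  Tail-dist [] = refl
  Tail-dist (top {a = a} _ t) = dist-top a
  Tail-dist (low {a = a} x≤B t) = trans (dist-low a (<⇒≢ (s≤s x≤B))) (cong suc (Tail-dist t))

  gaps : List ℕ → List ℕ
  gaps [] = []
  gaps (x ∷ a) with B ≤? x
  ... | yes _ = suc (dist a) ∷ gaps a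
  ... | no  _ = gaps a

  gaps-high : ∀ {x} a → B ≤ x → gaps (x ∷ a) ≡ suc (dist a) ∷ gaps a
  gaps-high {x} a p with B ≤? x
  ... | yes _ = refl
  ... | no ¬p = contradiction p ¬p

  gaps-low : ∀ {x} a → x < B → gaps (x ∷ a) ≡ gaps a
  gaps-low {x} a p with B ≤? x
  ... | yes q = contradiction q (<⇒≱ p)
  ... | no _ = refl

  gaps-++ : ∀ a c → gaps (a ++ suc B ∷ c) ≡ gaps a ++ suc (dist c) ∷ gaps c
  gaps-++ [] c = gaps-high c (n≤1+n B)
  gaps-++ (x ∷ a) c with B ≤? x
  ... | yes _ = cong₂ _∷_ (cong suc (dist-++ a c)) (gaps-++ a c)
  ... | no  _ = gaps-++ a c

  allGaps : ∀ {i} → Vec (List ℕ) i → List ℕ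
  allGaps [] = []
  allGaps (a ∷ ts) = gaps a ++ allGaps ts

  -- When a block is inserted, its prefix is just the opening letter, which therefore joins the two
  -- entries around it. The index says after which of the `i` present blocks it stands.
  merge : ∀ {i} → Fin i → Vec (List ℕ) (suc i) → Vec (List ℕ) i
  merge zero    (a ∷ c ∷ ts) = (a ++ suc B ∷ c) ∷ ts
  merge (suc k) (a ∷ ts)     = a ∷ merge k ts

  plain : ∀ i → List (Vec ℕ i)
  plain zero    = [] ∷ []
  plain (suc i) = cartesianProductWith _∷_ (upTo B) (plain i)

  -- All letters of a column have the same distance to the next top, so at most one of them may be
  -- `B`; everything below the first `B` is plain.
  columns : ∀ i → List (Vec ℕ i)
  columns zero    = [] ∷ []
  columns (suc i) = cartesianProductWith _∷_ (upTo B) (columns i) ++ map (B ∷_) (plain i)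

  data Column : ∀ {i} → Vec ℕ i → Set where
    []   : Column []
    low  : ∀ {i x} {xs : Vec ℕ i} → x < B → Column xs → Column (x ∷ xs)
    high : ∀ {i} {xs : Vec ℕ i} → VAll.All (_< B) xs → Column (B ∷ xs)

  plain-< : ∀ i → All (VAll.All (_< B)) (plain i)
  plain-< zero = [] ∷ []
  plain-< (suc i) = AllP.cartesianProductWith⁺ (setoid _) (setoid _) _∷_ (upTo B) (plain i)
    λ p q → ∈-upTo⁻ p ∷ All.lookup (plain-< i) q

  columns-Column : ∀ i → All Column (columns i)
  columns-Column zero = [] ∷ []
  columns-Column (suc i) = AllP.++⁺
    (AllP.cartesianProductWith⁺ (setoid _) (setoid _) _∷_ (upTo B) (columns i)
      λ p q → low (∈-upTo⁻ p) (All.lookup (columns-Column i) q))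
    (AllP.map⁺ (All.map high (plain-< i)))

  length-plain : ∀ i → length (plain i) ≡ B ^ i
  length-plain zero = refl
  length-plain (suc i) = trans (length-cartesianProductWith _∷_ (upTo B) (plain i))
    (cong₂ _*_ (length-applyUpTo (λ z → z) B) (length-plain i))

  length-columns-suc : ∀ i → length (columns (suc i)) ≡ B * length (columns i) + B ^ i
  length-columns-suc i = trans (length-++ (cartesianProductWith _∷_ (upTo B) (columns i)))
    (cong₂ _+_ (trans (length-cartesianProductWith _∷_ (upTo B) (columns i))
                      (cong (_* length (columns i)) (length-applyUpTo (λ z → z) B)))
               (trans (length-map (B ∷_) (plain i)) (length-plain i)))

  plain-unique : ∀ i → Unique (plain i)
  plain-unique zero = [] ∷ []
  plain-unique (suc i) = UniqueP.cartesianProductWith⁺ _∷_ VecP.∷-injective (UniqueP.upTo⁺ B) (plain-unique i)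

  columns-unique : ∀ i → Unique (columns i)
  columns-unique zero = [] ∷ []
  columns-unique (suc i) = UniqueP.++⁺
    (UniqueP.cartesianProductWith⁺ _∷_ VecP.∷-injective (UniqueP.upTo⁺ B) (columns-unique i))
    (UniqueP.map⁺ (proj₂ ∘ VecP.∷-injective) (plain-unique i))
    λ (p , q) → disjoint (∈-cartesianProductWith⁻ _∷_ (upTo B) (columns i) p) (∈-map⁻ (B ∷_) q)
    where
    disjoint : ∀ {v} → (∃₂ λ x xs → x ∈ upTo B × xs ∈ columns i × v ≡ x ∷ xs) → (∃ λ xs → xs ∈ plain i × v ≡ B ∷ xs) → ⊥
    disjoint (x , _ , x∈ , _ , refl) (_ , _ , eq) = <⇒≢ (∈-upTo⁻ x∈) (proj₁ (VecP.∷-injective eq))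

  grow : ∀ {i} → Fin i × Vec ℕ i → Vec (List ℕ) (suc i) → Vec (List ℕ) i
  grow (k , x) ts = zipWith _∷_ x (merge k ts)

  -- With i blocks present, each lacking its last v letters, and blocks of lengths ≤ v of total length n
  -- still to be inserted, entry k of a vector is what stands between the k-th prefix and the next one.
  gen : ℕ → ∀ i → ℕ → List (Vec (List ℕ) i)
  gen zero    i zero    = replicate i [] ∷ []
  gen zero    i (suc n) = []
  gen (suc v) i n with suc v ≤ᵇ n
  ... | true  = cartesianProductWith (zipWith _∷_) (columns i) (gen v i n) ++
                cartesianProductWith grow (cartesianProduct (allFin i) (plain i)) (gen v (suc i) (n ∸ suc v))
  ... | false = cartesianProductWith (zipWith _∷_) (columns i) (gen v i n)

  total : ∀ {i} → Vec (List ℕ) i → ℕ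
  total [] = 0
  total (a ∷ ts) = length a + total ts

  -- The invariant of `gen`. By `bounded` the gap `suc v` is still free for the next step. In
  -- `size`, each of the `i` entries has `v` letters of its own block, and the inserted blocks make
  -- up `n`.
  record Good (v : ℕ) {i} (n : ℕ) (ts : Vec (List ℕ) i) : Set where
    constructor good
    field
      tails    : VAll.All (Tail v v) ts
      unique   : Unique (allGaps ts)
      bounded  : All (_≤ v) (allGaps ts)
      size     : total ts ≡ v * i + n

  -- The new top is followed by an entry with exactly `v` letters before its next top, so its gap is
  -- `suc v`; no other gap changes, because the end of an entry already counted as a top.
  merge-gaps : ∀ {i v} k (ts : Vec (List ℕ) (suc i)) → VAll.All (Tail v v) ts → allGaps (merge k ts) ↭ suc v ∷ allGaps ts
  merge-gaps {v = v} zero (a ∷ c ∷ ts) (_ ∷ t ∷ _)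
    rewrite gaps-++ a c | Tail-dist t | ++-assoc (gaps a) (suc v ∷ gaps c) (allGaps ts)
    = shift (suc v) (gaps a) (gaps c ++ allGaps ts)
  merge-gaps {v = v} (suc k) (a ∷ ts) (_ ∷ g) = ↭.trans (++⁺ˡ (gaps a) (merge-gaps k ts g))
    (shift (suc v) (gaps a) (allGaps ts))

  merge-tails : ∀ {i v} k (ts : Vec (List ℕ) (suc i)) → VAll.All (Tail v v) ts → VAll.All (Tail (suc v) v) (merge k ts)
  merge-tails zero (a ∷ c ∷ ts) (t ∷ u ∷ g) = Tail-++ (Tail-weaken t) ≤-refl (Tail-weaken u) ∷ VAll.map Tail-weaken g
  merge-tails (suc k) (a ∷ ts) (t ∷ g) = Tail-weaken t ∷ merge-tails k ts g

  merge-total : ∀ {i} k (ts : Vec (List ℕ) (suc i)) → total (merge k ts) ≡ suc (total ts)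
  merge-total zero (a ∷ c ∷ ts) = trans (cong (_+ total ts) (trans (length-++ a) (+-suc (length a) (length c))))
    (cong suc (+-assoc (length a) (length c) (total ts)))
  merge-total (suc k) (a ∷ ts) = trans (cong (length a +_) (merge-total k ts)) (+-suc (length a) (total ts))

  column-tails : ∀ {i v} {xs : Vec ℕ i} ts → VAll.All (_≤ B) xs → VAll.All (Tail (suc v) v) ts →
    VAll.All (Tail (suc v) (suc v)) (zipWith _∷_ xs ts)
  column-tails [] [] [] = []
  column-tails (a ∷ ts) (p ∷ ps) (t ∷ g) = low p t ∷ column-tails ts ps g

  column-total : ∀ {i} (xs : Vec ℕ i) ts → total (zipWith _∷_ xs ts) ≡ i + total ts
  column-total [] [] = refl
  column-total {suc i} (x ∷ xs) (a ∷ ts) = cong suc (trans (cong (length a +_) (column-total xs ts))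
    (trans (sym (+-assoc (length a) i _)) (trans (cong (_+ total ts) (+-comm (length a) i)) (+-assoc i _ _))))

  plain-gaps : ∀ {i} (xs : Vec ℕ i) ts → VAll.All (_< B) xs → allGaps (zipWith _∷_ xs ts) ≡ allGaps ts
  plain-gaps [] [] [] = refl
  plain-gaps (x ∷ xs) (a ∷ ts) (p ∷ ps) = cong₂ _++_ (gaps-low a p) (plain-gaps xs ts ps)

  column-gaps : ∀ {i v} (xs : Vec ℕ i) ts → Column xs → VAll.All (Tail v v) ts →
    allGaps (zipWith _∷_ xs ts) ≡ allGaps ts ⊎ allGaps (zipWith _∷_ xs ts) ↭ suc v ∷ allGaps ts
  column-gaps [] [] [] [] = inj₁ refl
  column-gaps {v = v} (x ∷ xs) (a ∷ ts) (low p c) (t ∷ g) rewrite gaps-low a p with column-gaps xs ts c g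
  ... | inj₁ eq = inj₁ (cong (gaps a ++_) eq)
  ... | inj₂ s  = inj₂ (↭.trans (++⁺ˡ (gaps a) s) (shift (suc v) (gaps a) (allGaps ts)))
  column-gaps (.B ∷ xs) (a ∷ ts) (high ps) (t ∷ g) rewrite gaps-high a (≤-refl {B}) | plain-gaps xs ts ps | Tail-dist t = inj₂ ↭.refl

  Column-≤ : ∀ {i} {xs : Vec ℕ i} → Column xs → VAll.All (_≤ B) xs
  Column-≤ [] = []
  Column-≤ (low p c) = <⇒≤ p ∷ Column-≤ c
  Column-≤ (high ps) = ≤-refl ∷ VAll.map <⇒≤ ps

  -- The new gap, from a letter `B` or from a new top, exceeds all old ones.
  add-gap : ∀ {v xs ys} → Unique ys → All (_≤ v) ys → xs ↭ suc v ∷ ys → Unique xs × All (_≤ suc v) xs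
  add-gap u b s = ↭ₛ.Unique-resp-↭ (setoid ℕ) (↭⇒↭ₛ (↭.↭-sym s)) (All.map (λ p → <⇒≢ (s≤s p) ∘ sym) b ∷ u)
                , All-resp-↭ (↭.↭-sym s) (≤-refl ∷ All.map m≤n⇒m≤1+n b)

  step-size : ∀ v i n → i + (v * i + n) ≡ suc v * i + n
  step-size v i n = sym (+-assoc i (v * i) n)

  extend-good : ∀ {v i n} {xs : Vec ℕ i} {ts} → Column xs → Good v n ts → Good (suc v) n (zipWith _∷_ xs ts)
  extend-good {v} {i} {n} {xs} {ts} c (good t u b s) = good
    (column-tails ts (Column-≤ c) (VAll.map Tail-weaken t)) (proj₁ ub) (proj₂ ub)
    (trans (column-total xs ts) (trans (cong (i +_) s) (step-size v i n)))
    where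
    ub : Unique (allGaps (zipWith _∷_ xs ts)) × All (_≤ suc v) (allGaps (zipWith _∷_ xs ts))
    ub with column-gaps xs ts c t
    ... | inj₁ eq = subst Unique (sym eq) u , subst (All (_≤ suc v)) (sym eq) (All.map m≤n⇒m≤1+n b)
    ... | inj₂ p  = add-gap u b p

  grow-good : ∀ {v i n} {xs : Vec ℕ i} {k ts} → suc v ≤ n → VAll.All (_< B) xs → Good v (n ∸ suc v) ts →
    Good (suc v) n (grow (k , xs) ts)
  grow-good {v} {i} {n} {xs} {k} {ts} v<n ps (good t u b s) = good
    (column-tails (merge k ts) (VAll.map <⇒≤ ps) (merge-tails k ts t)) (proj₁ ub) (proj₂ ub)
    (begin
      total (grow (k , xs) ts) ≡⟨ column-total xs (merge k ts) ⟩
      i + total (merge k ts)   ≡⟨ cong (i +_) (merge-total k ts) ⟩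
      i + suc (total ts)       ≡⟨ cong (λ z → i + suc z) s ⟩
      i + suc (v * suc i + (n ∸ suc v)) ≡⟨ cong (λ z → i + suc (z + (n ∸ suc v))) (*-suc v i) ⟩
      i + suc (v + v * i + (n ∸ suc v)) ≡⟨ regroup i v (v * i) (n ∸ suc v) ⟩
      i + (v * i + (suc v + (n ∸ suc v))) ≡⟨ cong (λ z → i + (v * i + z)) (m+[n∸m]≡n v<n) ⟩
      i + (v * i + n)          ≡⟨ step-size v i n ⟩
      suc v * i + n ∎)
    where
    open ≡-Reasoning
    regroup : ∀ i v w m → i + suc (v + w + m) ≡ i + (w + (suc v + m))
    regroup = solve-∀
    ub : Unique (allGaps (grow (k , xs) ts)) × All (_≤ suc v) (allGaps (grow (k , xs) ts))
    ub = add-gap u b (subst (_↭ suc v ∷ allGaps ts) (sym (plain-gaps xs (merge k ts) ps)) (merge-gaps k ts t))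

  empty-good : ∀ i → Good 0 0 (replicate i [])
  empty-good i = good (tails i) (subst Unique (sym (none i)) []) (subst (All (_≤ 0)) (sym (none i)) []) (zeros i)
    where
    tails : ∀ i → VAll.All (Tail 0 0) (replicate i [])
    tails zero = []
    tails (suc i) = [] ∷ tails i
    none : ∀ i → allGaps (replicate i []) ≡ []
    none zero = refl
    none (suc i) = none i
    zeros : ∀ i → total (replicate i []) ≡ 0
    zeros zero = refl
    zeros (suc i) = zeros i

  gen-good : ∀ v i n → All (Good v n) (gen v i n)
  gen-good zero i zero = empty-good i ∷ []
  gen-good zero i (suc n) = []
  gen-good (suc v) i n with suc v ≤ᵇ n in eq
  ... | true  = AllP.++⁺
        (AllP.cartesianProductWith⁺ (setoid _) (setoid _) (zipWith _∷_) (columns i) (gen v i n)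
          λ p q → extend-good (All.lookup (columns-Column i) p) (All.lookup (gen-good v i n) q))
        (AllP.cartesianProductWith⁺ (setoid _) (setoid _) grow (cartesianProduct (allFin i) (plain i)) (gen v (suc i) (n ∸ suc v))
          λ p q → grow-good (≤ᵇ-true⁻ (suc v) n eq)
            (All.lookup (plain-< i) (proj₂ (∈-cartesianProduct⁻ (allFin i) (plain i) p)))
            (All.lookup (gen-good v (suc i) (n ∸ suc v)) q))
  ... | false = AllP.cartesianProductWith⁺ (setoid _) (setoid _) (zipWith _∷_) (columns i) (gen v i n)
          λ p q → extend-good (All.lookup (columns-Column i) p) (All.lookup (gen-good v i n) q)

  -- A tail has no block of length suc v, which is how a merge at level suc v is recognised.
  no-block : ∀ {v r} a {a′ c} → Tail v r a′ → Tail v v c → a ++ suc B ∷ c ≢ a′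
  no-block [] (top r<v t) u refl = <⇒≢ r<v (trans (sym (Tail-dist t)) (Tail-dist u))
  no-block [] (low x≤B t) u refl = <⇒≱ ≤-refl x≤B
  no-block (x ∷ a) (top _ t) u refl = no-block a t u refl
  no-block (x ∷ a) (low _ t) u refl = no-block a t u refl

  -- If one cut came before the other, the tail after the earlier cut would contain the block of
  -- length `suc v` opened at the later one.
  split-unique : ∀ {v} a a′ {c c′} → Tail v v c → Tail v v c′ → a ++ suc B ∷ c ≡ a′ ++ suc B ∷ c′ → a ≡ a′ × c ≡ c′
  split-unique [] [] _ _ refl = refl , refl
  split-unique [] (x ∷ a′) t t′ refl = contradiction refl (no-block a′ t t′)
  split-unique (x ∷ a) [] t t′ refl = contradiction refl (no-block a t′ t)
  split-unique (x ∷ a) (y ∷ a′) t t′ eq with ListP.∷-injective eq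
  ... | refl , eq′ with split-unique a a′ t t′ eq′
  ... | refl , refl = refl , refl

  -- Separates the two branches of `gen`: only after a merge does an entry contain a block of length
  -- `suc v`.
  merge-fresh : ∀ {i v} (k : Fin i) ts ts′ → VAll.All (Tail v v) ts → VAll.All (Tail v v) ts′ → merge k ts ≢ ts′
  merge-fresh zero (a ∷ c ∷ ts) (a′ ∷ ts′) (_ ∷ u ∷ _) (t ∷ _) eq = no-block a t u (proj₁ (VecP.∷-injective eq))
  merge-fresh (suc k) (a ∷ ts) (a′ ∷ ts′) (_ ∷ g) (_ ∷ g′) eq = merge-fresh k ts ts′ g g′ (proj₂ (VecP.∷-injective eq))

  -- At the smaller of two different positions, only one of the vectors would have a block of length
  -- `suc v`. At equal positions the cut is unique.
  merge-injective : ∀ {i v} (k k′ : Fin i) ts ts′ → VAll.All (Tail v v) ts → VAll.All (Tail v v) ts′ →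
    merge k ts ≡ merge k′ ts′ → k ≡ k′ × ts ≡ ts′
  merge-injective zero zero (a ∷ c ∷ ts) (a′ ∷ c′ ∷ ts′) (_ ∷ t ∷ _) (_ ∷ t′ ∷ _) eq with VecP.∷-injective eq
  ... | eq₁ , refl with split-unique a a′ t t′ eq₁
  ... | refl , refl = refl , refl
  merge-injective zero (suc k′) (a ∷ c ∷ ts) (a′ ∷ ts′) (_ ∷ u ∷ _) (t′ ∷ _) eq =
    contradiction (proj₁ (VecP.∷-injective eq)) (no-block a t′ u)
  merge-injective (suc k) zero (a ∷ ts) (a′ ∷ c′ ∷ ts′) (t ∷ _) (_ ∷ u ∷ _) eq =
    contradiction (sym (proj₁ (VecP.∷-injective eq))) (no-block a′ t u)
  merge-injective (suc k) (suc k′) (a ∷ ts) (a′ ∷ ts′) (_ ∷ g) (_ ∷ g′) eq with VecP.∷-injective eq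
  ... | refl , eq′ with merge-injective k k′ ts ts′ g g′ eq′
  ... | refl , refl = refl , refl

  gen-tails : ∀ v n {i ts} → ts ∈ gen v i n → VAll.All (Tail v v) ts
  gen-tails v n {i} p = Good.tails (All.lookup (gen-good v i n) p)

  gen-unique : ∀ v i n → Unique (gen v i n)
  gen-unique zero i zero = [] ∷ []
  gen-unique zero i (suc n) = []
  gen-unique (suc v) i n with suc v ≤ᵇ n
  ... | false = UniqueP.cartesianProductWith⁺ (zipWith _∷_) (zipWith-∷-injective _ _ _ _) (columns-unique i) (gen-unique v i n)
  ... | true = UniqueP.++⁺
    (UniqueP.cartesianProductWith⁺ (zipWith _∷_) (zipWith-∷-injective _ _ _ _) (columns-unique i) (gen-unique v i n))
    (Unique-cartesianProductWith∈ grow injective (UniqueP.cartesianProduct⁺ (UniqueP.allFin⁺ i) (plain-unique i))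
      (gen-unique v (suc i) (n ∸ suc v)))
    λ (p , q) → disjoint (∈-cartesianProductWith⁻ (zipWith _∷_) (columns i) (gen v i n) p)
      (∈-cartesianProductWith⁻ grow (cartesianProduct (allFin i) (plain i)) (gen v (suc i) (n ∸ suc v)) q)
    where
    injective : ∀ {kx kx′ : Fin i × Vec ℕ i} {ts ts′} → ts ∈ gen v (suc i) (n ∸ suc v) → ts′ ∈ gen v (suc i) (n ∸ suc v) →
      grow kx ts ≡ grow kx′ ts′ → kx ≡ kx′ × ts ≡ ts′
    injective {k , x} {k′ , x′} {ts} {ts′} p q eq with zipWith-∷-injective x x′ _ _ eq
    ... | refl , eq′ with merge-injective k k′ ts ts′ (gen-tails v (n ∸ suc v) p) (gen-tails v (n ∸ suc v) q) eq′
    ... | refl , refl = refl , refl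
    disjoint : ∀ {w} → (∃₂ λ x ts → x ∈ columns i × ts ∈ gen v i n × w ≡ zipWith _∷_ x ts) →
      (∃₂ λ kx ts → kx ∈ cartesianProduct (allFin i) (plain i) × ts ∈ gen v (suc i) (n ∸ suc v) × w ≡ grow kx ts) → ⊥
    disjoint (x , ts , _ , p , refl) ((k , x′) , ts′ , _ , q , eq) =
      merge-fresh k ts′ ts (gen-tails v (n ∸ suc v) q) (gen-tails v n p) (sym (proj₂ (zipWith-∷-injective x x′ _ _ eq)))

  -- Words are listed without their leading letter suc B; v + 1 is the length of the first block.
  words : ℕ → ℕ → List (List ℕ)
  words zero    n = []
  words (suc v) n with suc v ≤ᵇ n
  ... | true  = words v n ++ map Vec.head (gen v 1 (n ∸ suc v))
  ... | false = words v n

  -- The omitted opening letter has gap `suc run`, and all other gaps are at most `run`. This strict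
  -- maximum marks where the period starts, so no two rotations of a word are both listed.
  record Admissible (n : ℕ) (a : List ℕ) : Set where
    constructor admissible
    field
      {run}   : ℕ
      tail    : Tail run run a
      unique  : Unique (gaps a)
      bounded : All (_≤ run) (gaps a)
      size    : suc (length a) ≡ n

  head-admissible : ∀ {v n ts} → suc v ≤ n → Good v {1} (n ∸ suc v) ts → Admissible n (Vec.head ts)
  head-admissible {v} {n} {a ∷ []} v<n (good (t ∷ []) u b s) = admissible t
    (subst Unique (++-identityʳ (gaps a)) u) (subst (All (_≤ v)) (++-identityʳ (gaps a)) b)
    (trans (cong suc (trans (sym (+-identityʳ (length a))) (trans s (cong (_+ (n ∸ suc v)) (*-identityʳ v)))))
      (m+[n∸m]≡n v<n))

  words-admissible : ∀ v n → All (Admissible n) (words v n)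
  words-admissible zero n = []
  words-admissible (suc v) n with suc v ≤ᵇ n in eq
  ... | true = AllP.++⁺ (words-admissible v n) (AllP.map⁺
        (All.map (head-admissible (≤ᵇ-true⁻ (suc v) n eq)) (gen-good v 1 (n ∸ suc v))))
  ... | false = words-admissible v n

  -- Keeps words with different first block lengths apart in `words-unique`.
  words-dist : ∀ v n → All (λ a → dist a < v) (words v n)
  words-dist zero n = []
  words-dist (suc v) n with suc v ≤ᵇ n
  ... | true = AllP.++⁺ (All.map m<n⇒m<1+n (words-dist v n)) (AllP.map⁺
        (All.map (λ { {a ∷ []} g → s≤s (≤-reflexive (Tail-dist (VAll.head (Good.tails g)))) }) (gen-good v 1 (n ∸ suc v))))
  ... | false = All.map m<n⇒m<1+n (words-dist v n)

  words-unique : ∀ v n → Unique (words v n)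
  words-unique zero n = []
  words-unique (suc v) n with suc v ≤ᵇ n
  ... | true = UniqueP.++⁺ (words-unique v n) (UniqueP.map⁺ head-injective (gen-unique v 1 (n ∸ suc v)))
        λ (p , q) → disjoint p (∈-map⁻ Vec.head q)
    where
    head-injective : ∀ {x y : Vec (List ℕ) 1} → Vec.head x ≡ Vec.head y → x ≡ y
    head-injective {_ ∷ []} {_ ∷ []} refl = refl
    disjoint : ∀ {a} → a ∈ words v n → (∃ λ ts → ts ∈ gen v 1 (n ∸ suc v) × a ≡ Vec.head ts) → ⊥
    disjoint p (a ∷ [] , q , refl) = <⇒≢ (All.lookup (words-dist v n) p) (Tail-dist (VAll.head (gen-tails v (n ∸ suc v) q)))
  ... | false = words-unique v n

-- From admissible words to prime patterns

shift-cards : ∀ {b} → Cards b → ℕ → Cards b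
shift-cards {b} C r = record
  { card = λ s → card (s + r)
  ; card≤ = λ s → card≤ (s + r)
  ; recurs = λ s → proj₁ (recurs (s + r)) , trans (cong card (+-assoc _ s r)) (proj₂ (recurs (s + r)))
  }
  where open Cards C

nextTop-unique : ∀ {b} {C : Cards b} {s e e′} → NextTop C s e → NextTop C s e′ → e ≡ e′
nextTop-unique {e = e} {e′} x y with <-cmp e e′
... | tri≈ _ eq _ = eq
... | tri< lt _ _ = contradiction (NextTop.top x) (NextTop.none y (NextTop.positive x) lt)
... | tri> _ _ gt = contradiction (NextTop.top y) (NextTop.none x (NextTop.positive y) gt)

nextTop-shift : ∀ {b} {C D : Cards b} r → (∀ s → Cards.card D s ≡ Cards.card C (s + r)) →
  ∀ {s e} → NextTop D s e → NextTop C (s + r) e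
nextTop-shift {C = C} {D} r h {s} {e} nt = record
  { positive = NextTop.positive nt
  ; top = trans (sym (move e)) (NextTop.top nt)
  ; none = λ {j} p q → NextTop.none nt p q ∘ trans (move j)
  }
  where
  move : ∀ j → Cards.card D (j + s) ≡ Cards.card C (j + (s + r))
  move j = trans (h (j + s)) (cong (Cards.card C) (+-assoc j s r))

module _ (B : ℕ) where
  open Words B

  -- Reading past the end gives suc B, the letter that opens the next period.
  at : List ℕ → ℕ → ℕ
  at []      _       = suc B
  at (x ∷ w) zero    = x
  at (x ∷ w) (suc i) = at w i

  at-≤ : ∀ {w} → All (_≤ suc B) w → ∀ i → at w i ≤ suc B
  at-≤ [] i = ≤-refl
  at-≤ (p ∷ ps) zero = p
  at-≤ (p ∷ ps) (suc i) = at-≤ ps i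

  at-drop : ∀ k w j → at (drop k w) j ≡ at w (k + j)
  at-drop zero w j = refl
  at-drop (suc k) [] j = refl
  at-drop (suc k) (x ∷ w) j = at-drop k w j

  at-length : ∀ w → at w (length w) ≡ suc B
  at-length [] = refl
  at-length (x ∷ w) = at-length w

  at-ext : ∀ {w w′} → length w ≡ length w′ → (∀ i → i < length w → at w i ≡ at w′ i) → w ≡ w′
  at-ext {[]} {[]} _ _ = refl
  at-ext {x ∷ w} {y ∷ w′} eq h = cong₂ _∷_ (h 0 (s≤s z≤n)) (at-ext (suc-injective eq) λ i p → h (suc i) (s≤s p))

  at-dist : ∀ w → at w (dist w) ≡ suc B
  at-dist [] = refl
  at-dist (x ∷ w) with x ≟ suc B
  ... | yes p = p
  ... | no _  = at-dist w

  at-before-dist : ∀ w j → j < dist w → at w j ≢ suc B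
  at-before-dist (x ∷ w) j p with x ≟ suc B
  at-before-dist (x ∷ w) zero _ | no ¬q = ¬q
  at-before-dist (x ∷ w) (suc j) (s≤s p) | no _ = at-before-dist w j p

  dist≤length : ∀ w → dist w ≤ length w
  dist≤length [] = z≤n
  dist≤length (x ∷ w) with x ≟ suc B
  ... | yes _ = z≤n
  ... | no _  = s≤s (dist≤length w)

  gapAt : List ℕ → ℕ → ℕ
  gapAt w r = suc (dist (drop (suc r) w))

  gapAt∈ : ∀ w r → r < length w → B ≤ at w r → gapAt w r ∈ gaps w
  gapAt∈ (x ∷ w) zero _ p rewrite gaps-high w p = here refl
  gapAt∈ (x ∷ w) (suc r) (s≤s lt) p with B ≤? x
  ... | yes _ = there (gapAt∈ w r lt p)
  ... | no _  = gapAt∈ w r lt p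

  gaps-tail-unique : ∀ x w → Unique (gaps (x ∷ w)) → Unique (gaps w)
  gaps-tail-unique x w u with B ≤? x
  ... | yes _ = AllPairs.tail u
  ... | no _  = u

  gapAt-injective : ∀ w r r′ → Unique (gaps w) → r < length w → r′ < length w → B ≤ at w r → B ≤ at w r′ →
    gapAt w r ≡ gapAt w r′ → r ≡ r′
  gapAt-injective (x ∷ w) zero zero u _ _ _ _ _ = refl
  gapAt-injective (x ∷ w) zero (suc r′) u _ (s≤s l) p p′ eq rewrite gaps-high w p =
    contradiction eq (All.lookup (AllPairs.head u) (gapAt∈ w r′ l p′))
  gapAt-injective (x ∷ w) (suc r) zero u (s≤s l) _ p p′ eq rewrite gaps-high w p′ =
    contradiction (sym eq) (All.lookup (AllPairs.head u) (gapAt∈ w r l p))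
  gapAt-injective (x ∷ w) (suc r) (suc r′) u (s≤s l) (s≤s l′) p p′ eq =
    cong suc (gapAt-injective w r r′ (gaps-tail-unique x w u) l l′ p p′ eq)

  module Periodic (m : ℕ) (a : List ℕ) (adm : Admissible (suc m) a) where
    open Admissible adm

    n : ℕ
    n = suc m

    word : List ℕ
    word = suc B ∷ a

    card : ℕ → ℕ
    card s = at word (s % n)

    card-periodic : ∀ s k → card (s + k * n) ≡ card s
    card-periodic s k = cong (at word) ([m+kn]%n≡m%n s k n)

    cards : Cards (suc B)
    cards = record
      { card = card
      ; card≤ = λ s → at-≤ (≤-refl ∷ Tail-letters tail) (s % n)
      -- The time `s * m + s` is `s * n`, where a period opens with the top letter.
      ; recurs = λ s → s * m , cong (at word) (trans (cong (_% n) (trans (+-comm (s * m) s) (sym (*-suc s m)))) (m*n%n≡0 s n))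
      }

    word-unique : Unique (gaps word)
    word-unique rewrite gaps-high a (n≤1+n B) | Tail-dist tail = All.map (λ p → <⇒≢ (s≤s p) ∘ sym) bounded ∷ unique

    card-after : ∀ τ j → j ≤ length (drop (suc (τ % n)) word) → card (suc j + τ) ≡ at (drop (suc (τ % n)) word) j
    card-after τ j j≤ = trans (cong (at word) (trans (cong (_% n) split) ([m+kn]%n≡m%n (suc (r + j)) (τ / n) n))) (trans wrap (sym (at-drop (suc r) word j)))
      where
      r : ℕ
      r = τ % n
      split : suc j + τ ≡ suc (r + j) + τ / n * n
      split = cong suc (trans (cong (j +_) (m≡m%n+[m/n]*n τ n)) (trans (sym (+-assoc j r _)) (cong (_+ τ / n * n) (+-comm j r))))
      drop-length : ∀ k (w : List ℕ) → length (drop k w) ≡ length w ∸ k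
      drop-length zero w = refl
      drop-length (suc k) [] = refl
      drop-length (suc k) (x ∷ w) = drop-length k w
      inside : suc (r + j) ≤ n
      inside = ≤-trans (+-monoʳ-≤ (suc r) (≤-trans j≤ (≤-reflexive (trans (drop-length (suc r) word) (cong (_∸ suc r) size)))))
        (≤-reflexive (m+[n∸m]≡n (m%n<n τ n)))
      wrap : at word (suc (r + j) % n) ≡ at word (suc (r + j))
      wrap with m≤n⇒m<n∨m≡n inside
      ... | inj₁ lt = cong (at word) (m<n⇒m%n≡m lt)
      -- The index just past the word reduces to 0; the opening letter there equals the default
      -- value of `at`.
      ... | inj₂ eq = trans (cong (at word) (trans (cong (_% n) eq) (n%n≡0 n)))
                        (sym (trans (cong (at word) (trans eq (sym size))) (at-length word)))

    nextTop-gapAt : ∀ τ → NextTop cards τ (gapAt word (τ % n))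
    nextTop-gapAt τ = record
      { positive = s≤s z≤n
      ; top = trans (card-after τ (dist rest) (dist≤length rest)) (at-dist rest)
      ; none = λ { {suc j} _ (s≤s lt) eq → at-before-dist rest j lt
          (trans (sym (card-after τ j (≤-trans (<⇒≤ lt) (dist≤length rest)))) eq) }
      }
      where
      rest : List ℕ
      rest = drop (suc (τ % n)) word

    %<length : ∀ τ → τ % n < length word
    %<length τ = subst (τ % n <_) (sym size) (m%n<n τ n)

    gaps-injective : ∀ {τ τ′ e} → B ≤ card τ → B ≤ card τ′ → NextTop cards τ e → NextTop cards τ′ e → τ % n ≡ τ′ % n
    gaps-injective {τ} {τ′} p p′ x x′ = gapAt-injective word (τ % n) (τ′ % n) word-unique (%<length τ) (%<length τ′) p p′
      (trans (nextTop-unique (nextTop-gapAt τ) x) (nextTop-unique x′ (nextTop-gapAt τ′)))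

    first-gap : ℕ
    first-gap = suc (dist a)

    nextTop-first : NextTop cards 0 first-gap
    nextTop-first = nextTop-gapAt 0

    first-gap-largest : ∀ {τ e} → B ≤ card τ → NextTop cards τ e → e ≤ first-gap
    first-gap-largest {τ} {e} p x = subst (_≤ first-gap) (nextTop-unique (nextTop-gapAt τ) x)
      (All.lookup all≤ (gapAt∈ word (τ % n) (%<length τ) p))
      where
      all≤ : All (_≤ first-gap) (gaps word)
      all≤ rewrite gaps-high a (n≤1+n B) = ≤-refl ∷ All.map (λ q → ≤-trans q (≤-trans (≤-reflexive (sym (Tail-dist tail))) (n≤1+n _))) bounded

    primePattern : 1 ≤ B → PrimePattern (suc B) n
    primePattern 1≤B = record
      { st = Cards.state cards
      ; periodic = λ k i → cong (1 ≤ᵇ_) (sym (lev-per k i))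
      ; step = Cards.state-transition cards
      ; distinct = states-distinct 1≤B cards n gaps-injective
      }
      where
      per : ∀ s → card s ≡ card (s + n)
      per s = trans (sym (card-periodic s 1)) (cong (λ z → card (s + z)) (*-identityˡ n))
      lev-per : ∀ k i → Levels.lev card k i ≡ Levels.lev card (k + n) i
      lev-per = lev-cong n per

  module _ {m : ℕ} {a a′ : List ℕ} (adm : Admissible (suc m) a) (adm′ : Admissible (suc m) a′) where
    private
      module W = Periodic m a adm
      module W′ = Periodic m a′ adm′

    rotated-first-gap : ∀ r → (∀ s → W′.card s ≡ W.card (s + r)) → W′.first-gap ≤ W.first-gap
    rotated-first-gap r h = W.first-gap-largest {r} (≤-trans (n≤1+n B) (≤-reflexive (h 0)))
      (nextTop-shift r h W′.nextTop-first)

  -- The rotation and its inverse bound the two first gaps by each other, so they are equal.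
  -- Position `r` then has the same gap as position 0, and injectivity of gaps makes `r` a multiple
  -- of the period.
  rotation-trivial : ∀ {m a a′} (adm : Admissible (suc m) a) (adm′ : Admissible (suc m) a′) r →
    (∀ s → Periodic.card m a′ adm′ s ≡ Periodic.card m a adm (s + r)) → a ≡ a′
  rotation-trivial {m} {a} {a′} adm adm′ r h = drop-head (at-ext (trans (Admissible.size adm) (sym (Admissible.size adm′)))
      λ i lt → trans (cong (at W.word) (sym (small i lt))) (trans (sym (same i)) (cong (at W′.word) (small i lt))))
    where
    module W = Periodic m a adm
    module W′ = Periodic m a′ adm′
    drop-head : W.word ≡ W′.word → a ≡ a′
    drop-head refl = refl
    small : ∀ i → i < length W.word → i % suc m ≡ i
    small i lt = m<n⇒m%n≡m (subst (i <_) (Admissible.size adm) lt)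
    -- Shifting by `r * m` inverts the rotation, as `r * m + r` is `r` whole periods.
    back : ∀ s → W.card s ≡ W′.card (s + r * m)
    back s = sym (trans (h (s + r * m)) (trans (cong W.card (trans (+-assoc s (r * m) r)
      (cong (s +_) (trans (+-comm (r * m) r) (sym (*-suc r m)))))) (W.card-periodic s r)))
    same-gap : W′.first-gap ≡ W.first-gap
    same-gap = ≤-antisym (rotated-first-gap adm adm′ r h) (rotated-first-gap adm′ adm (r * m) back)
    r%n≡0 : r % suc m ≡ 0
    r%n≡0 = W.gaps-injective {r} {0} (≤-trans (n≤1+n B) (≤-reflexive (h 0))) (n≤1+n B)
      (nextTop-shift r h W′.nextTop-first) (subst (NextTop W.cards 0) (sym same-gap) W.nextTop-first)
    same : ∀ s → W′.card s ≡ W.card s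
    same s = trans (h s) (trans (cong (λ z → W.card (s + z)) (trans (m≡m%n+[m/n]*n r (suc m)) (cong (_+ r / suc m * suc m) r%n≡0)))
      (W.card-periodic s (r / suc m)))

  module _ (1≤B : 1 ≤ B) (m : ℕ) where

    toPattern : ∀ {a} → Admissible (suc m) a → PrimePattern (suc B) (suc m)
    toPattern adm = Periodic.primePattern m _ adm 1≤B

    -- Equal states force equal letters, applied to the second word and the rotated first one. This
    -- reduces the claim to `rotation-trivial`.
    samePattern⇒≡ : ∀ {a a′} (adm : Admissible (suc m) a) (adm′ : Admissible (suc m) a′) →
      SamePattern (toPattern adm) (toPattern adm′) → a ≡ a′
    samePattern⇒≡ adm adm′ (r , h) = rotation-trivial adm adm′ r
      (cards-agree {n = suc m} W′.cards (shift-cards W.cards r)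
        (λ s i → trans (h s i) (cong (1 ≤ᵇ_) (sym (lev-cong {c = W.card} r (λ _ → refl) s i))))
        W′.card-periodic λ s k → trans (cong W.card (swap s (k * suc m) r)) (W.card-periodic (s + r) k))
      where
      module W = Periodic m _ adm
      module W′ = Periodic m _ adm′
      swap : ∀ x y z → x + y + z ≡ x + z + y
      swap x y z = trans (+-assoc x y z) (trans (cong (x +_) (+-comm y z)) (sym (+-assoc x z y)))

    patterns : ∀ {as} → All (Admissible (suc m)) as → List (PrimePattern (suc B) (suc m))
    patterns [] = []
    patterns (adm ∷ adms) = toPattern adm ∷ patterns adms

    length-patterns : ∀ {as} (adms : All (Admissible (suc m)) as) → length (patterns adms) ≡ length as
    length-patterns [] = refl
    length-patterns (_ ∷ adms) = cong suc (length-patterns adms)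

    patterns-distinct : ∀ {as} (adms : All (Admissible (suc m)) as) → Unique as → PairwiseDistinct (patterns adms)
    patterns-distinct [] [] = []
    patterns-distinct {a ∷ _} (adm ∷ adms) (a∉ ∷ u) = apart adms a∉ ∷ patterns-distinct adms u
      where
      apart : ∀ {as} (adms : All (Admissible (suc m)) as) → All (a ≢_) as →
        All (λ Q → ¬ SamePattern (toPattern adm) Q) (patterns adms)
      apart [] [] = []
      apart (adm′ ∷ adms) (a≢ ∷ rest) = (a≢ ∘ samePattern⇒≡ adm adm′) ∷ apart adms rest

-- Counting the words

open import Data.Nat.Combinatorics using (_C_; nCk≡nC[n∸k]; nCn≡1; nC1≡n; nCk+nC[k+1]≡[n+1]C[k+1])

-- Absorption identities for binomial coefficients

nC0≡1 : ∀ n → n C 0 ≡ 1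
nC0≡1 n = trans (nCk≡nC[n∸k] {k = 0} {n} z≤n) (nCn≡1 n)

suc-k*nCk : ∀ n k → suc k * (suc n C suc k) ≡ suc n * (n C k)
suc-k*nCk n zero = trans (*-identityˡ (suc n C 1)) (trans (nC1≡n (suc n)) (sym (trans (cong (suc n *_) (nC0≡1 n)) (*-identityʳ (suc n)))))
suc-k*nCk zero (suc k) = trans (cong (suc (suc k) *_) (k>n⇒nCk≡0 {1} {suc (suc k)} (s≤s (s≤s z≤n)))) (trans (*-zeroʳ (suc (suc k)))
  (sym (trans (+-identityʳ (0 C suc k)) (k>n⇒nCk≡0 {0} {suc k} (s≤s z≤n)))))
suc-k*nCk (suc n) (suc k) = begin
  suc (suc k) * (suc (suc n) C suc (suc k))
    ≡⟨ cong (suc (suc k) *_) (nCk+nC[k+1]≡[n+1]C[k+1] (suc n) (suc k)) ⟨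
  suc (suc k) * (x + y)
    ≡⟨ expand (suc k) x y ⟩
  x + (suc k * x + suc (suc k) * y)
    ≡⟨ cong (x +_) (cong₂ _+_ (suc-k*nCk n k) (suc-k*nCk n (suc k))) ⟩
  x + (suc n * (n C k) + suc n * (n C suc k))
    ≡⟨ cong (x +_) (*-distribˡ-+ (suc n) (n C k) (n C suc k)) ⟨
  x + suc n * (n C k + n C suc k)
    ≡⟨ cong (λ z → x + suc n * z) (nCk+nC[k+1]≡[n+1]C[k+1] n k) ⟩
  suc (suc n) * x ∎
  where
  open ≡-Reasoning
  x = suc n C suc k
  y = suc n C suc (suc k)
  expand : ∀ k x y → suc k * (x + y) ≡ x + (k * x + suc k * y)
  expand = solve-∀

-- Symmetry exchanges the lower index `b` for `j`, where absorption applies.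
suc-j*C : ∀ j b → suc j * ((suc j + b) C b) ≡ (suc j + b) * ((j + b) C b)
suc-j*C j b = begin
  suc j * ((suc j + b) C b)       ≡⟨ cong (suc j *_) (trans (nCk≡nC[n∸k] (m≤n+m b (suc j))) (cong ((suc j + b) C_) (m+n∸n≡m (suc j) b))) ⟩
  suc j * (suc (j + b) C suc j)   ≡⟨ suc-k*nCk (j + b) j ⟩
  suc (j + b) * ((j + b) C j)     ≡⟨ cong (suc (j + b) *_) (trans (nCk≡nC[n∸k] (m≤n+m b j)) (cong ((j + b) C_) (m+n∸n≡m j b))) ⟨
  suc (j + b) * ((j + b) C b) ∎
  where open ≡-Reasoning

-- Fractions, powers and sums of rationals

frac-* : ∀ a d c e → frac a (suc d) ℚ.* frac c (suc e) ≡ frac (a * c) (suc d * suc e)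
frac-* a d c e = ℚP.toℚᵘ-injective (begin-equality
  toℚᵘ (fromℚᵘ p ℚ.* fromℚᵘ q)         ≃⟨ ℚP.toℚᵘ-homo-* (fromℚᵘ p) (fromℚᵘ q) ⟩
  toℚᵘ (fromℚᵘ p) ℚᵘ.* toℚᵘ (fromℚᵘ q) ≃⟨ ℚᵘP.*-cong (ℚP.toℚᵘ-fromℚᵘ p) (ℚP.toℚᵘ-fromℚᵘ q) ⟩
  p ℚᵘ.* q                             ≃⟨ *≡* (cong (ℤ._* (ℤ.+ (suc d * suc e))) (sym (ℤP.pos-* a c))) ⟩
  r                                    ≃⟨ ℚP.toℚᵘ-fromℚᵘ r ⟨
  toℚᵘ (fromℚᵘ r) ∎)
  where
  open ℚᵘP.≤-Reasoning
  p = mkℚᵘ (ℤ.+ a) d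
  q = mkℚᵘ (ℤ.+ c) e
  r = mkℚᵘ (ℤ.+ (a * c)) (e + d * suc e)

frac-cong : ∀ {a d c e} → a * suc e ≡ c * suc d → frac a (suc d) ≡ frac c (suc e)
frac-cong {a} {d} {c} {e} eq = ℚP.fromℚᵘ-cong {mkℚᵘ (ℤ.+ a) d} {mkℚᵘ (ℤ.+ c) e}
  (*≡* (trans (sym (ℤP.pos-* a (suc e))) (trans (cong ℤ.+_ eq) (ℤP.pos-* c (suc d)))))

ι : ℕ → ℚ
ι a = frac a 1

ι-* : ∀ a c → ι (a * c) ≡ ι a ℚ.* ι c
ι-* a c = sym (frac-* a 0 c 0)

ι-+ : ∀ a c → ι (a + c) ≡ ι a ℚ.+ ι c
ι-+ a c = ℚP.toℚᵘ-injective (begin-equality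
  toℚᵘ (fromℚᵘ r)                      ≃⟨ ℚP.toℚᵘ-fromℚᵘ r ⟩
  r                                    ≃⟨ *≡* (cong (ℤ._* (ℤ.+ 1)) (trans (ℤP.pos-+ a c) (sym (cong₂ ℤ._+_ (ℤP.*-identityʳ (ℤ.+ a)) (ℤP.*-identityʳ (ℤ.+ c)))))) ⟩
  p ℚᵘ.+ q                             ≃⟨ ℚᵘP.+-cong (ℚP.toℚᵘ-fromℚᵘ p) (ℚP.toℚᵘ-fromℚᵘ q) ⟨
  toℚᵘ (fromℚᵘ p) ℚᵘ.+ toℚᵘ (fromℚᵘ q) ≃⟨ ℚP.toℚᵘ-homo-+ (fromℚᵘ p) (fromℚᵘ q) ⟨
  toℚᵘ (fromℚᵘ p ℚ.+ fromℚᵘ q) ∎)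
  where
  open ℚᵘP.≤-Reasoning
  p = mkℚᵘ (ℤ.+ a) 0
  q = mkℚᵘ (ℤ.+ c) 0
  r = mkℚᵘ (ℤ.+ (a + c)) 0

ι-^ : ∀ a k → ι (a ^ k) ≡ ι a ^ℚ k
ι-^ a zero = refl
ι-^ a (suc k) = trans (ι-* a (a ^ k)) (cong (ι a ℚ.*_) (ι-^ a k))

frac-split : ∀ a d → frac a (suc d) ≡ ι a ℚ.* frac 1 (suc d)
frac-split a d = trans (frac-cong {a} {d} {a * 1} {d + 0} (cong₂ _*_ (sym (*-identityʳ a)) (cong suc (+-identityʳ d))))
  (sym (frac-* a 0 1 d))

frac-cancel : ∀ a d → frac a (suc d) ℚ.* ι (suc d) ≡ ι a
frac-cancel a d = trans (frac-* a d (suc d) 0) (frac-cong {a * suc d} {d * 1} {a} {0}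
  (trans (*-identityʳ (a * suc d)) (cong (λ z → a * suc z) (sym (*-identityʳ d)))))

*-interchange : ∀ w x y z → (w ℚ.* x) ℚ.* (y ℚ.* z) ≡ (w ℚ.* y) ℚ.* (x ℚ.* z)
*-interchange = solve 4 (λ w x y z → (w :* x) :* (y :* z) := (w :* y) :* (x :* z)) refl

^ℚ-distrib-* : ∀ p q k → (p ℚ.* q) ^ℚ k ≡ (p ^ℚ k) ℚ.* (q ^ℚ k)
^ℚ-distrib-* p q zero = refl
^ℚ-distrib-* p q (suc k) = trans (cong ((p ℚ.* q) ℚ.*_) (^ℚ-distrib-* p q k)) (*-interchange p q (p ^ℚ k) (q ^ℚ k))

^ℚ-+ : ∀ p k l → p ^ℚ (k + l) ≡ (p ^ℚ k) ℚ.* (p ^ℚ l)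
^ℚ-+ p zero l = sym (ℚP.*-identityˡ (p ^ℚ l))
^ℚ-+ p (suc k) l = trans (cong (p ℚ.*_) (^ℚ-+ p k l)) (sym (ℚP.*-assoc p (p ^ℚ k) (p ^ℚ l)))

sumℚ-++ : ∀ xs ys → sumℚ (xs ++ ys) ≡ sumℚ xs ℚ.+ sumℚ ys
sumℚ-++ [] ys = sym (ℚP.+-identityˡ (sumℚ ys))
sumℚ-++ (x ∷ xs) ys = trans (cong (x ℚ.+_) (sumℚ-++ xs ys)) (sym (ℚP.+-assoc x (sumℚ xs) (sumℚ ys)))

sumℚ-map-* : ∀ q (f : X → ℚ) xs → sumℚ (map (λ x → q ℚ.* f x) xs) ≡ q ℚ.* sumℚ (map f xs)
sumℚ-map-* q f [] = sym (ℚP.*-zeroʳ q)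
sumℚ-map-* q f (x ∷ xs) = trans (cong (q ℚ.* f x ℚ.+_) (sumℚ-map-* q f xs)) (sym (ℚP.*-distribˡ-+ q (f x) (sumℚ (map f xs))))

sumℚ-map-scale : ∀ q (f g : X → ℚ) → (∀ x → f x ≡ q ℚ.* g x) → ∀ xs → sumℚ (map f xs) ≡ q ℚ.* sumℚ (map g xs)
sumℚ-map-scale q f g eq xs = trans (cong sumℚ (map-cong eq xs)) (sumℚ-map-* q g xs)

sumℚ-map-∷ : ∀ q (f g : List ℕ → ℚ) v → (∀ ps → f (v ∷ ps) ≡ q ℚ.* g ps) → ∀ xs →
  sumℚ (map f (map (v ∷_) xs)) ≡ q ℚ.* sumℚ (map g xs)
sumℚ-map-∷ q f g v eq xs = trans (cong sumℚ (sym (map-∘ xs))) (sumℚ-map-scale q (f ∘ (v ∷_)) g eq xs)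

-- The bound as a sum over non-empty strict partitions

mutual
  -- The underscore is solved by the sum over non-empty partitions, local to lowerBound.
  restrictedSum : ℕ → ℕ → List (List ℕ) → ℚ
  restrictedSum b n xss = _

  lowerBound-restrictedSum : ∀ b n → lowerBound b n ≡ restrictedSum b n (strictPartitions n)
  lowerBound-restrictedSum b n with strictPartitions n
  ... | xss = refl {x = restrictedSum b n xss}

NonEmpty : List ℕ → Set
NonEmpty xs = ∃₂ λ x ys → xs ≡ x ∷ ys

restrictedSum-nonEmpty : ∀ b n xss → All NonEmpty xss →
  restrictedSum b n xss ≡ frac 1 b ℚ.* sumℚ (map (summand b n) xss)
restrictedSum-nonEmpty b n [] [] = refl
restrictedSum-nonEmpty b n (.(x ∷ ys) ∷ xss) ((x , ys , refl) ∷ ne) =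
  trans (ℚP.*-distribˡ-+ (frac 1 b) s _)
    (trans (cong (frac 1 b ℚ.* s ℚ.+_) (restrictedSum-nonEmpty b n xss ne)) (sym (ℚP.*-distribˡ-+ (frac 1 b) s _)))
  where
  s : ℚ
  s = summand b n (x ∷ ys)

strictParts-nonEmpty : ∀ v n → All NonEmpty (strictParts v (suc n))
strictParts-nonEmpty zero n = []
strictParts-nonEmpty (suc v) n with suc v ≤ᵇ suc n
... | true  = AllP.++⁺ (strictParts-nonEmpty v n) (AllP.map⁺ (All.universal (λ ps → suc v , ps , refl) _))
... | false = strictParts-nonEmpty v n

-- Evaluating the number of words

module Count (A : ℕ) where
  B b : ℕ
  B = suc A
  b = suc B
  open Words B

  col : ℕ → ℕ
  col i = length (columns i)

  -- A column has no `B` or one `B` in one of `i` places. The factor `B` on the left avoids the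
  -- exponent `i - 1`.
  col-closed : ∀ i → B * col i ≡ B ^ i * (i + B)
  col-closed zero = trans (*-identityʳ B) (sym (*-identityˡ B))
  col-closed (suc i) = begin
    B * col (suc i)                       ≡⟨ cong (B *_) (length-columns-suc i) ⟩
    B * (B * col i + B ^ i)               ≡⟨ cong (λ z → B * (z + B ^ i)) (col-closed i) ⟩
    B * (B ^ i * (i + B) + B ^ i)         ≡⟨ collect B (B ^ i) (i + B) ⟩
    B * B ^ i * suc (i + B) ∎
    where
    open ≡-Reasoning
    collect : ∀ x y z → x * (y * z + y) ≡ x * y * suc z
    collect = solve-∀

  col-suc : ∀ i → col (suc i) ≡ B ^ i * (i + b)
  col-suc i = trans (length-columns-suc i) (trans (cong (_+ B ^ i) (col-closed i))
    (trans (+-comm _ (B ^ i)) (trans (sym (*-suc (B ^ i) (i + B))) (cong (B ^ i *_) (sym (+-suc i B))))))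

  ratio : ℕ → ℚ
  ratio i = frac (i + b) (suc (i + A))

  col-ratio : ∀ i → (ι (col i) ℚ.* ι B) ℚ.* ratio i ≡ ι (col (suc i))
  col-ratio i = begin
    (ι (col i) ℚ.* ι B) ℚ.* ratio i              ≡⟨ cong₂ ℚ._*_ (trans (sym (ι-* (col i) B)) (cong ι (trans (*-comm (col i) B) (trans (col-closed i) (cong (B ^ i *_) (+-suc i A)))))) refl ⟩
    ι (B ^ i * suc (i + A)) ℚ.* ratio i          ≡⟨ cong (ℚ._* ratio i) (ι-* (B ^ i) (suc (i + A))) ⟩
    (ι (B ^ i) ℚ.* ι (suc (i + A))) ℚ.* ratio i  ≡⟨ ℚP.*-assoc (ι (B ^ i)) (ι (suc (i + A))) (ratio i) ⟩
    ι (B ^ i) ℚ.* (ι (suc (i + A)) ℚ.* ratio i)  ≡⟨ cong (ι (B ^ i) ℚ.*_) (trans (ℚP.*-comm (ι (suc (i + A))) (ratio i)) (frac-cancel (i + b) (i + A))) ⟩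
    ι (B ^ i) ℚ.* ι (i + b)                      ≡⟨ ι-* (B ^ i) (i + b) ⟨
    ι (B ^ i * (i + b))                          ≡⟨ cong ι (col-suc i) ⟨
    ι (col (suc i)) ∎
    where open ≡-Reasoning

  -- The proportion `i / (i + b)` of the choices in an inserting step to all columns for `i + 1`
  -- blocks.
  insertion : ℕ → ℚ
  insertion i = frac i (suc (i + B))

  col-insertion : ∀ i → ι (col (suc i)) ℚ.* insertion i ≡ ι (i * B ^ i)
  col-insertion i = begin
    ι (col (suc i)) ℚ.* insertion i                    ≡⟨ cong (λ z → ι z ℚ.* insertion i) (trans (col-suc i) (cong (B ^ i *_) (+-suc i B))) ⟩
    ι (B ^ i * suc (i + B)) ℚ.* insertion i            ≡⟨ cong (ℚ._* insertion i) (ι-* (B ^ i) (suc (i + B))) ⟩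
    (ι (B ^ i) ℚ.* ι (suc (i + B))) ℚ.* insertion i    ≡⟨ ℚP.*-assoc (ι (B ^ i)) (ι (suc (i + B))) (insertion i) ⟩
    ι (B ^ i) ℚ.* (ι (suc (i + B)) ℚ.* insertion i)    ≡⟨ cong (ι (B ^ i) ℚ.*_) (trans (ℚP.*-comm (ι (suc (i + B))) (insertion i)) (frac-cancel i (i + B))) ⟩
    ι (B ^ i) ℚ.* ι i                                  ≡⟨ trans (ℚP.*-comm (ι (B ^ i)) (ι i)) (sym (ι-* i (B ^ i))) ⟩
    ι (i * B ^ i) ∎
    where open ≡-Reasoning

  insertions : ℕ → ℕ → ℚ
  insertions i zero    = 1ℚ
  insertions i (suc m) = insertion i ℚ.* insertions (suc i) m

  -- The product telescopes: each factor is a quotient of consecutive binomial coefficients by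
  -- `suc-j*C`. For `j = 0` this produces the denominator of the bound.
  insertions-binomial : ∀ j m → insertions (suc j) m ℚ.* ι ((m + (j + b)) C b) ≡ ι ((j + b) C b)
  insertions-binomial j zero = ℚP.*-identityˡ _
  insertions-binomial j (suc m) = begin
    (ins ℚ.* rest) ℚ.* ι ((suc m + (j + b)) C b)     ≡⟨ ℚP.*-assoc ins rest _ ⟩
    ins ℚ.* (rest ℚ.* ι ((suc m + (j + b)) C b))     ≡⟨ cong (λ z → ins ℚ.* (rest ℚ.* ι (z C b))) (sym (+-suc m (j + b))) ⟩
    ins ℚ.* (rest ℚ.* ι ((m + (suc j + b)) C b))     ≡⟨ cong (ins ℚ.*_) (insertions-binomial (suc j) m) ⟩
    ins ℚ.* ι ((suc j + b) C b)                      ≡⟨ cong (ℚ._* ι ((suc j + b) C b)) (trans (frac-split (suc j) (suc j + B)) (ℚP.*-comm (ι (suc j)) unit)) ⟩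
    (unit ℚ.* ι (suc j)) ℚ.* ι ((suc j + b) C b)     ≡⟨ ℚP.*-assoc unit (ι (suc j)) _ ⟩
    unit ℚ.* (ι (suc j) ℚ.* ι ((suc j + b) C b))     ≡⟨ cong (unit ℚ.*_) (trans (sym (ι-* (suc j) ((suc j + b) C b))) (trans (cong ι (suc-j*C j b)) (ι-* (suc j + b) ((j + b) C b)))) ⟩
    unit ℚ.* (ι (suc j + b) ℚ.* ι ((j + b) C b))     ≡⟨ ℚP.*-assoc unit (ι (suc j + b)) _ ⟨
    (unit ℚ.* ι (suc j + b)) ℚ.* ι ((j + b) C b)     ≡⟨ cong (ℚ._* ι ((j + b) C b)) (trans (cong (λ z → unit ℚ.* ι z) (+-suc (suc j) B)) (frac-cancel 1 (suc j + B))) ⟩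
    1ℚ ℚ.* ι ((j + b) C b)                           ≡⟨ ℚP.*-identityˡ _ ⟩
    ι ((j + b) C b) ∎
    where
    open ≡-Reasoning
    ins = insertion (suc j)
    rest = insertions (suc (suc j)) m
    unit = frac 1 (suc (suc j + B))

  insertions-1 : ∀ m → frac 1 ((m + b) C b) ≡ insertions 1 m
  insertions-1 m with (m + b) C b | trans (insertions-binomial 0 m) (cong ι (nCn≡1 b))
  -- The binomial coefficient is nonzero, since its product with `insertions 1 m` is 1.
  ... | zero | eq = contradiction (trans (sym (ℚP.*-zeroʳ (insertions 1 m))) eq) λ ()
  ... | suc c | eq = begin
    frac 1 (suc c)                                       ≡⟨ ℚP.*-identityˡ _ ⟨
    1ℚ ℚ.* frac 1 (suc c)                                ≡⟨ cong (ℚ._* frac 1 (suc c)) eq ⟨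
    (insertions 1 m ℚ.* ι (suc c)) ℚ.* frac 1 (suc c)    ≡⟨ ℚP.*-assoc (insertions 1 m) (ι (suc c)) _ ⟩
    insertions 1 m ℚ.* (ι (suc c) ℚ.* frac 1 (suc c))    ≡⟨ cong (insertions 1 m ℚ.*_) (trans (ℚP.*-comm (ι (suc c)) (frac 1 (suc c))) (frac-cancel 1 c)) ⟩
    insertions 1 m ℚ.* 1ℚ                                ≡⟨ ℚP.*-identityʳ _ ⟩
    insertions 1 m ∎
    where open ≡-Reasoning

  -- For `ps` in `strictParts v n`, the number of vectors in `gen v i n` with inserted block lengths
  -- `ps`. A part `p` adds one block to `p` columns, a factor `B` times `ratio` for each of them,
  -- and `insertion` corrects the column where the block opens.
  weight : ℕ → ℕ → ℕ → List ℕ → ℚ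
  weight v i n ps = ((ι (col i) ^ℚ v) ℚ.* (ι B ^ℚ n)) ℚ.* (prodFactor b (suc i) ps ℚ.* insertions i (length ps))

  prodFactor-ratio : ∀ i → frac (suc i + b ∸ 1) (suc i + b ∸ 2) ≡ ratio i
  prodFactor-ratio i = cong (frac (i + b)) (cong (_∸ 1) (trans (+-suc i B) (cong suc (+-suc i A))))

  weight-same : ∀ v i n ps → weight (suc v) i n ps ≡ ι (col i) ℚ.* weight v i n ps
  weight-same v i n ps = solve 4 (λ c cv bn p → ((c :* cv) :* bn) :* p := c :* ((cv :* bn) :* p)) refl
    (ι (col i)) (ι (col i) ^ℚ v) (ι B ^ℚ n) (prodFactor b (suc i) ps ℚ.* insertions i (length ps))

  -- The part turns all `suc v` factors `col i` into `col (suc i)`. One of these, times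
  -- `insertion i`, becomes the number of insertions, and `v` remain.
  weight-new : ∀ v i n → suc v ≤ n → ∀ ps →
    weight (suc v) i n (suc v ∷ ps) ≡ ι (i * B ^ i) ℚ.* weight v (suc i) (n ∸ suc v) ps
  weight-new v i n v<n ps = begin
    ((c ^ℚ w) ℚ.* (β ^ℚ n)) ℚ.* (((frac (suc i + b ∸ 1) (suc i + b ∸ 2) ^ℚ w) ℚ.* P) ℚ.* (f ℚ.* K))
      ≡⟨ cong₂ (λ x y → ((c ^ℚ w) ℚ.* x) ℚ.* (((y ^ℚ w) ℚ.* P) ℚ.* (f ℚ.* K)))
           (trans (cong (β ^ℚ_) (sym (m+[n∸m]≡n v<n))) (^ℚ-+ β w (n ∸ w))) (prodFactor-ratio i) ⟩
    ((c ^ℚ w) ℚ.* ((β ^ℚ w) ℚ.* y)) ℚ.* (((ρ ^ℚ w) ℚ.* P) ℚ.* (f ℚ.* K))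
      ≡⟨ solve 7 (λ cw βw y ρw P f K → (cw :* (βw :* y)) :* ((ρw :* P) :* (f :* K)) :=
                                       (((cw :* βw) :* ρw) :* f) :* (y :* (P :* K))) refl
           (c ^ℚ w) (β ^ℚ w) y (ρ ^ℚ w) P f K ⟩
    ((((c ^ℚ w) ℚ.* (β ^ℚ w)) ℚ.* (ρ ^ℚ w)) ℚ.* f) ℚ.* (y ℚ.* (P ℚ.* K))
      ≡⟨ cong (λ z → (z ℚ.* f) ℚ.* (y ℚ.* (P ℚ.* K))) powers ⟩
    ((c′ ℚ.* (c′ ^ℚ v)) ℚ.* f) ℚ.* (y ℚ.* (P ℚ.* K))
      ≡⟨ solve 6 (λ c′ cv f y P K → ((c′ :* cv) :* f) :* (y :* (P :* K)) := (c′ :* f) :* ((cv :* y) :* (P :* K))) refl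
           c′ (c′ ^ℚ v) f y P K ⟩
    (c′ ℚ.* f) ℚ.* (((c′ ^ℚ v) ℚ.* y) ℚ.* (P ℚ.* K))
      ≡⟨ cong (ℚ._* (((c′ ^ℚ v) ℚ.* y) ℚ.* (P ℚ.* K))) (col-insertion i) ⟩
    ι (i * B ^ i) ℚ.* weight v (suc i) (n ∸ suc v) ps ∎
    where
    open ≡-Reasoning
    w = suc v
    c = ι (col i)
    c′ = ι (col (suc i))
    β = ι B
    ρ = ratio i
    y = β ^ℚ (n ∸ w)
    P = prodFactor b (suc (suc i)) ps
    f = insertion i
    K = insertions (suc i) (length ps)
    powers : ((c ^ℚ w) ℚ.* (β ^ℚ w)) ℚ.* (ρ ^ℚ w) ≡ c′ ^ℚ w
    powers = trans (cong (ℚ._* (ρ ^ℚ w)) (sym (^ℚ-distrib-* c β w)))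
      (trans (sym (^ℚ-distrib-* (c ℚ.* β) ρ w)) (cong (_^ℚ w) (col-ratio i)))

  length-grow : ∀ v i n → length (cartesianProductWith grow (cartesianProduct (allFin i) (plain i)) (gen v (suc i) n)) ≡
    i * B ^ i * length (gen v (suc i) n)
  length-grow v i n = trans (length-cartesianProductWith grow (cartesianProduct (allFin i) (plain i)) (gen v (suc i) n))
    (cong (_* length (gen v (suc i) n)) (trans (length-cartesianProductWith _,_ (allFin i) (plain i))
      (cong₂ _*_ (length-tabulate {n = i} (λ z → z)) (length-plain i))))

  -- The recursions of `strictParts` and `gen` branch on the same test, so the two weight recursions
  -- match the sum branch by branch.
  sum-weight : ∀ v i n → sumℚ (map (weight v i n) (strictParts v n)) ≡ ι (length (gen v i n))
  sum-weight zero i zero = refl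
  sum-weight zero i (suc n) = refl
  sum-weight (suc v) i n with suc v ≤ᵇ n in eq
  ... | false = begin
    sumℚ (map (weight (suc v) i n) (strictParts v n))     ≡⟨ sumℚ-map-scale (ι (col i)) (weight (suc v) i n) (weight v i n) (weight-same v i n) (strictParts v n) ⟩
    ι (col i) ℚ.* sumℚ (map (weight v i n) (strictParts v n)) ≡⟨ cong (ι (col i) ℚ.*_) (sum-weight v i n) ⟩
    ι (col i) ℚ.* ι (length (gen v i n))                  ≡⟨ ι-* (col i) (length (gen v i n)) ⟨
    ι (col i * length (gen v i n))                        ≡⟨ cong ι (length-cartesianProductWith (Vec.zipWith _∷_) (columns i) (gen v i n)) ⟨
    ι (length (cartesianProductWith (Vec.zipWith _∷_) (columns i) (gen v i n))) ∎
    where open ≡-Reasoning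
  ... | true = begin
    sumℚ (map (weight (suc v) i n) (strictParts v n ++ map (suc v ∷_) (strictParts v (n ∸ suc v))))
      ≡⟨ trans (cong sumℚ (map-++ (weight (suc v) i n) (strictParts v n) (map (suc v ∷_) (strictParts v (n ∸ suc v))))) (sumℚ-++ (map (weight (suc v) i n) (strictParts v n)) _) ⟩
    sumℚ (map (weight (suc v) i n) (strictParts v n)) ℚ.+ sumℚ (map (weight (suc v) i n) (map (suc v ∷_) (strictParts v (n ∸ suc v))))
      ≡⟨ cong₂ ℚ._+_ (sumℚ-map-scale (ι (col i)) (weight (suc v) i n) (weight v i n) (weight-same v i n) (strictParts v n))
                     (sumℚ-map-∷ (ι (i * B ^ i)) (weight (suc v) i n) (weight v (suc i) (n ∸ suc v)) (suc v) (weight-new v i n v<n) (strictParts v (n ∸ suc v))) ⟩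
    ι (col i) ℚ.* sumℚ (map (weight v i n) (strictParts v n)) ℚ.+
    ι (i * B ^ i) ℚ.* sumℚ (map (weight v (suc i) (n ∸ suc v)) (strictParts v (n ∸ suc v)))
      ≡⟨ cong₂ (λ x y → ι (col i) ℚ.* x ℚ.+ ι (i * B ^ i) ℚ.* y) (sum-weight v i n) (sum-weight v (suc i) (n ∸ suc v)) ⟩
    ι (col i) ℚ.* ι (length G) ℚ.+ ι (i * B ^ i) ℚ.* ι (length H)
      ≡⟨ cong₂ ℚ._+_ (ι-* (col i) (length G)) (ι-* (i * B ^ i) (length H)) ⟨
    ι (col i * length G) ℚ.+ ι (i * B ^ i * length H)
      ≡⟨ ι-+ (col i * length G) (i * B ^ i * length H) ⟨
    ι (col i * length G + i * B ^ i * length H)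
      ≡⟨ cong ι (trans (length-++ (cartesianProductWith (Vec.zipWith _∷_) (columns i) G))
           (cong₂ _+_ (length-cartesianProductWith (Vec.zipWith _∷_) (columns i) G) (length-grow v i (n ∸ suc v)))) ⟨
    ι (length (cartesianProductWith (Vec.zipWith _∷_) (columns i) G ++
               cartesianProductWith grow (cartesianProduct (allFin i) (plain i)) H)) ∎
    where
    open ≡-Reasoning
    G = gen v i n
    H = gen v (suc i) (n ∸ suc v)
    v<n : suc v ≤ n
    v<n = ≤ᵇ-true⁻ (suc v) n eq

  -- The largest part is the first block, and its factors combine to `b` to the power `suc v`. The
  -- prefactor `1 / b` removes one of them for the forced opening letter; the other `v` are columns
  -- of a single block, as `col 1` is `b`.
  summand-weight : ∀ v n → suc v ≤ n → ∀ ps → frac 1 b ℚ.* summand b n (suc v ∷ ps) ≡ weight v 1 (n ∸ suc v) ps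
  summand-weight v n v<n ps = begin
    frac 1 b ℚ.* (frac (B ^ n) ((suc m + b ∸ 1) C b) ℚ.* ((frac b B ^ℚ w) ℚ.* P))
      ≡⟨ cong (λ z → frac 1 b ℚ.* (z ℚ.* ((frac b B ^ℚ w) ℚ.* P))) normaliser ⟩
    frac 1 b ℚ.* (((β ^ℚ w) ℚ.* y) ℚ.* K ℚ.* ((frac b B ^ℚ w) ℚ.* P))
      ≡⟨ solve 6 (λ u βw y K ρw P → u :* (((βw :* y) :* K) :* (ρw :* P)) := (u :* (βw :* ρw)) :* (y :* (P :* K))) refl
           (frac 1 b) (β ^ℚ w) y K (frac b B ^ℚ w) P ⟩
    (frac 1 b ℚ.* ((β ^ℚ w) ℚ.* (frac b B ^ℚ w))) ℚ.* (y ℚ.* (P ℚ.* K))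
      ≡⟨ cong (λ z → (frac 1 b ℚ.* z) ℚ.* (y ℚ.* (P ℚ.* K)))
           (trans (sym (^ℚ-distrib-* β (frac b B) w)) (cong (_^ℚ w) (trans (ℚP.*-comm β (frac b B)) (frac-cancel b A)))) ⟩
    (frac 1 b ℚ.* (ι b ℚ.* (ι b ^ℚ v))) ℚ.* (y ℚ.* (P ℚ.* K))
      ≡⟨ solve 6 (λ u x xv y P K → (u :* (x :* xv)) :* (y :* (P :* K)) := (u :* x) :* ((xv :* y) :* (P :* K))) refl
           (frac 1 b) (ι b) (ι b ^ℚ v) y P K ⟩
    (frac 1 b ℚ.* ι b) ℚ.* (((ι b ^ℚ v) ℚ.* y) ℚ.* (P ℚ.* K))
      ≡⟨ trans (cong (ℚ._* (((ι b ^ℚ v) ℚ.* y) ℚ.* (P ℚ.* K))) (frac-cancel 1 B)) (ℚP.*-identityˡ _) ⟩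
    ((ι b ^ℚ v) ℚ.* y) ℚ.* (P ℚ.* K)
      ≡⟨ cong (λ z → ((ι z ^ℚ v) ℚ.* y) ℚ.* (P ℚ.* K)) (trans (col-suc 0) (*-identityˡ b)) ⟨
    weight v 1 (n ∸ suc v) ps ∎
    where
    open ≡-Reasoning
    w = suc v
    m = length ps
    β = ι B
    y = β ^ℚ (n ∸ w)
    P = prodFactor b 2 ps
    K = insertions 1 m
    split : ∀ a c → frac 1 c ≡ K → frac a c ≡ ι a ℚ.* K
    -- With denominator 0 both values of `frac` are 0, so the factorisation holds here as well.
    split a zero eq = trans (sym (ℚP.*-zeroʳ (ι a))) (cong (ι a ℚ.*_) eq)
    split a (suc c) eq = trans (frac-split a c) (cong (ι a ℚ.*_) eq)
    normaliser : frac (B ^ n) ((suc m + b ∸ 1) C b) ≡ ((β ^ℚ w) ℚ.* y) ℚ.* K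
    normaliser = trans (split (B ^ n) ((m + b) C b) (insertions-1 m)) (cong (ℚ._* K)
      (trans (ι-^ B n) (trans (cong (β ^ℚ_) (sym (m+[n∸m]≡n v<n))) (^ℚ-+ β w (n ∸ w)))))

  sum-summand : ∀ v n → sumℚ (map (λ ps → frac 1 b ℚ.* summand b (suc n) ps) (strictParts v (suc n))) ≡ ι (length (words v (suc n)))
  sum-summand zero n = refl
  sum-summand (suc v) n with suc v ≤ᵇ suc n in eq
  ... | false = sum-summand v n
  ... | true = begin
    sumℚ (map s (strictParts v (suc n) ++ map (suc v ∷_) parts))
      ≡⟨ trans (cong sumℚ (map-++ s (strictParts v (suc n)) (map (suc v ∷_) parts))) (sumℚ-++ (map s (strictParts v (suc n))) _) ⟩
    sumℚ (map s (strictParts v (suc n))) ℚ.+ sumℚ (map s (map (suc v ∷_) parts))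
      ≡⟨ cong₂ ℚ._+_ (sum-summand v n) (trans (cong sumℚ (trans (sym (map-∘ parts))
           (map-cong (summand-weight v (suc n) (≤ᵇ-true⁻ (suc v) (suc n) eq)) parts))) (sum-weight v 1 (n ∸ v))) ⟩
    ι (length (words v (suc n))) ℚ.+ ι (length (gen v 1 (n ∸ v)))
      ≡⟨ ι-+ (length (words v (suc n))) (length (gen v 1 (n ∸ v))) ⟨
    ι (length (words v (suc n)) + length (gen v 1 (n ∸ v)))
      ≡⟨ cong ι (trans (length-++ (words v (suc n))) (cong (λ z → length (words v (suc n)) + z) (length-map Vec.head (gen v 1 (n ∸ v))))) ⟨
    ι (length (words v (suc n) ++ map Vec.head (gen v 1 (n ∸ v)))) ∎
    where
    open ≡-Reasoning
    s : List ℕ → ℚ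
    s ps = frac 1 b ℚ.* summand b (suc n) ps
    parts = strictParts v (n ∸ v)

  lowerBound-words : ∀ n → lowerBound b (suc n) ≡ ι (length (words (suc n) (suc n)))
  lowerBound-words n = begin
    lowerBound b (suc n)                                         ≡⟨ lowerBound-restrictedSum b (suc n) ⟩
    restrictedSum b (suc n) (strictPartitions (suc n))           ≡⟨ restrictedSum-nonEmpty b (suc n) (strictPartitions (suc n)) (strictParts-nonEmpty (suc n) n) ⟩
    frac 1 b ℚ.* sumℚ (map (summand b (suc n)) (strictPartitions (suc n))) ≡⟨ sumℚ-map-* (frac 1 b) (summand b (suc n)) (strictPartitions (suc n)) ⟨
    sumℚ (map (λ ps → frac 1 b ℚ.* summand b (suc n) ps) (strictPartitions (suc n))) ≡⟨ sum-summand (suc n) n ⟩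
    ι (length (words (suc n) (suc n))) ∎
    where open ≡-Reasoning

theorem6p6 : (b n : ℕ) → 2 ≤ b → 1 ≤ n → atLeastPatterns b n (lowerBound b n)
theorem6p6 (suc (suc A)) (suc m) _ _ =
  patterns (suc A) (s≤s z≤n) m admissible-words ,
  patterns-distinct (suc A) (s≤s z≤n) m admissible-words (words-unique (suc m) (suc m)) ,
  ℚP.≤-reflexive (trans (lowerBound-words m) (cong ι (sym (length-patterns (suc A) (s≤s z≤n) m admissible-words))))
  where
  open Words (suc A)
  open Count A using (lowerBound-words)
  admissible-words = words-admissible (suc m) (suc m)
theorem6p6 (suc zero) _ (s≤s ()) _
theorem6p6 (suc (suc _)) zero _ ()
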